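{- The cuboid packing decision problem $P_0$ is weakly computable. That is, there is a deterministic algorithm which, on every input consisting of $n\in\mathbb{N}^+$ and positive real numbers $L,W,H,l_1,w_1,h_1,\dots,l_n,w_n,h_n$, halts after finitely many arithmetic or logical operations on real numbers, correctly decides whether all $n$ items can be feasibly placed into the container, and, if so, outputs a feasible placement (the position and orientation of each item).
   Context: The container is the cuboid $[0,L]\times[0,W]\times[0,H]\subset\mathbb{R}^3$. Item $i$ ($1\le i\le n$) is a cuboid with side lengths $l_i,w_i,h_i$. All parameters are positive real numbers. A placement assigns to each item $i$ one of its six orientations, so that its dimensions along the $x,y,z$ axes form one of $(l_i,w_i,h_i),(l_i,h_i,w_i),(w_i,l_i,h_i),(w_i,h_i,l_i),(h_i,l_i,w_i),(h_i,w_i,l_i)$, and a position $(x_i,y_i,z_i)\in\mathbb{R}^3$ of its vertex with smallest coordinates. The placement is feasible if every item lies completely in the container and any two items have intersection of volume $0$. Weak computability: a problem with real parameters is weakly computable if there is a deterministic algorithm that solves it, on every input, by finitely many arithmetic or logical operations on the real parameters, on a machine that can store real numbers exactly and perform each arithmetic operation ($+,-,\times,/$) and each comparison on them as a single step (real RAM / Blum–Shub–Smale type machine). -}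

module Defs where

open import Level using (Level; _⊔_) renaming (suc to lsuc)
open import Algebra.Bundles using (CommutativeRing)
open import Relation.Binary.Core using (Rel)
open import Relation.Binary.Bundles using (DecTotalOrder)
open import Relation.Binary.Structures using (IsDecTotalOrder)
import Relation.Binary.Construct.NonStrictToStrict as NonStrictToStrict
import Algebra.Construct.NaturalChoice.Min as Min
import Algebra.Construct.NaturalChoice.Max as Max
open import Data.Bool.Base using (Bool; if_then_else_)
open import Data.Fin.Base using (Fin; toℕ)
open import Data.Fin.Patterns using (0F; 1F; 2F; 3F; 4F; 5F)
open import Data.List.Base using (List; []; _∷_; _++_; concat; tabulate)
open import Data.Maybe.Base using (Maybe; just; nothing; maybe′)
open import Data.Nat as ℕ using (ℕ; zero; suc; _≡ᵇ_)
open import Data.Nat.DivMod using (_/_; _%_)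
open import Data.Nat.GeneralisedArithmetic using (iterate)
open import Data.Product.Base using (∃; ∃-syntax; Σ-syntax; _×_; _,_; proj₁; proj₂)
open import Data.Sum.Base using (_⊎_)
open import Function.Bundles using (_⇔_; mk⇔)
open import Relation.Binary.PropositionalEquality.Core using (_≡_; _≢_)
open import Relation.Nullary using (¬_; yes; no; does)

-- The real numbers, given by their axioms: a totally ordered field in which
-- every nonempty subset with an upper bound has a least upper bound.  Such a
-- field is unique up to isomorphism.  As in classical mathematics (and as the
-- machine below requires), the order and equality are decidable.

record RealNumbers (c ℓ₁ ℓ₂ p : Level) : Set (lsuc (c ⊔ ℓ₁ ⊔ ℓ₂ ⊔ p)) where
  field
    commutativeRing : CommutativeRing c ℓ₁

  open CommutativeRing commutativeRing public
    using (Carrier; _≈_; _+_; _*_; _-_; -_; 0#; 1#)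

  infix 4 _≤_
  field
    0≉1             : ¬ 0# ≈ 1#
    inverse         : ∀ x → ¬ x ≈ 0# → ∃[ y ] x * y ≈ 1#
    _≤_             : Rel Carrier ℓ₂
    isDecTotalOrder : IsDecTotalOrder _≈_ _≤_
    +-monoˡ-≤       : ∀ {x y} z → x ≤ y → x + z ≤ y + z
    *-nonneg        : ∀ {x y} → 0# ≤ x → 0# ≤ y → 0# ≤ x * y

  UpperBound : (Carrier → Set p) → Carrier → Set (c ⊔ ℓ₂ ⊔ p)
  UpperBound S b = ∀ x → S x → x ≤ b

  field
    supremum : ∀ (S : Carrier → Set p) → ∃ S → ∃ (UpperBound S) →
               ∃[ b ] UpperBound S b × (∀ b′ → UpperBound S b′ → b ≤ b′)

  decTotalOrder : DecTotalOrder c ℓ₁ ℓ₂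
  decTotalOrder = record { isDecTotalOrder = isDecTotalOrder }

  open DecTotalOrder decTotalOrder public using (_≟_; _≤?_; totalOrder)
  open NonStrictToStrict _≈_ _≤_ public using (_<_)

-- Programs of a real RAM.  The machine has integer registers N₀, N₁, …, real
-- registers X₀, X₁, …, and two infinite memories, one of integers and one of
-- reals, that are addressed indirectly through integer registers.  A program
-- is a finite syntactic object that mentions no real constants except 0 and 1;
-- in particular it depends neither on the input nor on its size.

data IntOp : Set where
  add monus mul quo rem : IntOp

data RealOp : Set where
  add sub mul div : RealOp

data Test : Set where
  N<N : (a b : ℕ) → Test   -- N_a < N_b
  X≤X : (a b : ℕ) → Test   -- X_a ≤ X_b

data Instr : Set where
  intConst  : (d m : ℕ) → Instr              -- N_d ≔ m
  intOp     : IntOp → (d a b : ℕ) → Instr    -- N_d ≔ N_a ∙ N_b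
  intLoad   : (d a : ℕ) → Instr              -- N_d ≔ intMem[N_a]
  intStore  : (a b : ℕ) → Instr              -- intMem[N_a] ≔ N_b
  realZero  : (d : ℕ) → Instr                -- X_d ≔ 0
  realOne   : (d : ℕ) → Instr                -- X_d ≔ 1
  realOp    : RealOp → (d a b : ℕ) → Instr   -- X_d ≔ X_a ∙ X_b
  realLoad  : (d a : ℕ) → Instr              -- X_d ≔ realMem[N_a]
  realStore : (a b : ℕ) → Instr              -- realMem[N_a] ≔ X_b
  branch    : Test → List Instr → List Instr → Instr
  while     : Test → List Instr → Instr

Program : Set
Program = List Instr

infixl 9 _[_≔_]

_[_≔_] : ∀ {a} {A : Set a} → (ℕ → A) → ℕ → A → (ℕ → A)
(f [ i ≔ v ]) j = if j ≡ᵇ i then v else f j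

module Machine {c ℓ₁ ℓ₂ p} (R : RealNumbers c ℓ₁ ℓ₂ p) where
  open RealNumbers R

  record State : Set c where
    constructor state
    field
      N       : ℕ → ℕ
      X       : ℕ → Carrier
      intMem  : ℕ → ℕ
      realMem : ℕ → Carrier

  -- The instructions still to be executed, and the current state.
  Config : Set c
  Config = Program × State

  evalInt : IntOp → ℕ → ℕ → Maybe ℕ
  evalInt add   m n       = just (m ℕ.+ n)
  evalInt monus m n       = just (m ℕ.∸ n)
  evalInt mul   m n       = just (m ℕ.* n)
  evalInt quo   m zero    = nothing
  evalInt quo   m (suc n) = just (m / suc n)
  evalInt rem   m zero    = nothing
  evalInt rem   m (suc n) = just (m % suc n)

  evalReal : RealOp → Carrier → Carrier → Maybe Carrier
  evalReal add x y = just (x + y)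
  evalReal sub x y = just (x - y)
  evalReal mul x y = just (x * y)
  evalReal div x y with y ≟ 0#
  ... | yes _  = nothing
  ... | no y≉0 = just (x * proj₁ (inverse y y≉0))

  evalTest : Test → State → Bool
  evalTest (N<N a b) (state N _ _ _) = does (N a ℕ.<? N b)
  evalTest (X≤X a b) (state _ X _ _) = does (X a ≤? X b)

  -- One step of the machine; it performs at most one arithmetic operation or
  -- comparison.  A division by zero leaves the configuration unchanged, so
  -- that the machine never halts.
  step : Config → Config
  step ([] , s) = [] , s
  step (intConst d m ∷ k , state N X I M) = k , state (N [ d ≔ m ]) X I M
  step κ@(intOp o d a b ∷ k , state N X I M) =
    maybe′ (λ m → k , state (N [ d ≔ m ]) X I M) κ (evalInt o (N a) (N b))
  step (intLoad d a ∷ k , state N X I M) = k , state (N [ d ≔ I (N a) ]) X I M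
  step (intStore a b ∷ k , state N X I M) = k , state N X (I [ N a ≔ N b ]) M
  step (realZero d ∷ k , state N X I M) = k , state N (X [ d ≔ 0# ]) I M
  step (realOne d ∷ k , state N X I M) = k , state N (X [ d ≔ 1# ]) I M
  step κ@(realOp o d a b ∷ k , state N X I M) =
    maybe′ (λ x → k , state N (X [ d ≔ x ]) I M) κ (evalReal o (X a) (X b))
  step (realLoad d a ∷ k , state N X I M) = k , state N (X [ d ≔ M (N a) ]) I M
  step (realStore a b ∷ k , state N X I M) = k , state N X I (M [ N a ≔ X b ])
  step (branch t P Q ∷ k , s) = (if evalTest t s then P else Q) ++ k , s
  step (while t P ∷ k , s) = (if evalTest t s then P ++ while t P ∷ k else k) , s

  Halts : Program → State → State → Set c
  Halts P s s′ = ∃[ t ] iterate step (P , s) t ≡ ([] , s′)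

  -- Reals that follow the given ones in memory are 0.
  memory : List Carrier → ℕ → Carrier
  memory []       _       = 0#
  memory (x ∷ xs) zero    = x
  memory (x ∷ xs) (suc i) = memory xs i

  -- The size of the input is in N₀ and its real parameters are in realMem.
  inputState : ℕ → List Carrier → State
  inputState n xs = state ((λ _ → 0) [ 0 ≔ n ]) (λ _ → 0#) (λ _ → 0) (memory xs)

  -- A problem with real parameters: its inputs, how they are presented to
  -- the machine, and which final states are correct answers to an input.
  record Problem (a b : Level) : Set (c ⊔ lsuc (a ⊔ b)) where
    field
      Input   : Set a
      size    : Input → ℕ
      params  : Input → List Carrier
      Correct : Input → State → Set b

  Solves : ∀ {a b} → Program → Problem a b → Set (a ⊔ b ⊔ c)
  Solves P problem =
    ∀ (x : Input) → ∃[ s ] Halts P (inputState (size x) (params x)) s × Correct x s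
    where open Problem problem

-- The program comes first: one algorithm for all inputs.

WeaklyComputable : ∀ {c ℓ₁ ℓ₂ p a b} →
                   ((R : RealNumbers c ℓ₁ ℓ₂ p) → Machine.Problem R a b) →
                   Set (lsuc (c ⊔ ℓ₁ ⊔ ℓ₂ ⊔ p) ⊔ a ⊔ b)
WeaklyComputable problem = Σ[ P ∈ Program ] (∀ R → Machine.Solves R P (problem R))

module Packing {c ℓ₁ ℓ₂ p} (R : RealNumbers c ℓ₁ ℓ₂ p) where
  open RealNumbers R
  open Machine R using (State)
  private
    module ⊓ = Min totalOrder
    module ⊔ = Max totalOrder
  open ⊓ using (_⊓_)
  open ⊔ renaming (_⊔_ to _⊔ᴿ_) using ()

  Point : Set c
  Point = Fin 3 → Carrier

  ⟨_,_,_⟩ : Carrier → Carrier → Carrier → Point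
  ⟨ x , y , z ⟩ 0F = x
  ⟨ x , y , z ⟩ 1F = y
  ⟨ x , y , z ⟩ 2F = z

  -- The axis-parallel box ∏ₖ [lo k , hi k]; it is empty if some hi k < lo k.
  record Box : Set c where
    constructor box
    field
      lo hi : Point

  _∈_ : Point → Box → Set ℓ₂
  q ∈ box lo hi = ∀ k → lo k ≤ q k × q k ≤ hi k

  _⊆_ : Box → Box → Set (c ⊔ ℓ₂)
  A ⊆ B = ∀ q → q ∈ A → q ∈ B

  _∩_ : Box → Box → Box
  box lo hi ∩ box lo′ hi′ = box (λ k → lo k ⊔ᴿ lo′ k) (λ k → hi k ⊓ hi′ k)

  ∈-∩ : ∀ {q} A B → q ∈ (A ∩ B) ⇔ (q ∈ A × q ∈ B)
  ∈-∩ {q} (box lo hi) (box lo′ hi′) = mk⇔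
    (λ q∈ →
      (λ k → ≤-trans (⊔.x≤x⊔y (lo k) (lo′ k)) (proj₁ (q∈ k))
           , ≤-trans (proj₂ (q∈ k)) (⊓.x⊓y≤x (hi k) (hi′ k))) ,
      (λ k → ≤-trans (⊔.x≤y⊔x (lo k) (lo′ k)) (proj₁ (q∈ k))
           , ≤-trans (proj₂ (q∈ k)) (⊓.x⊓y≤y (hi k) (hi′ k))))
    (λ (q∈A , q∈B) k →
      ⊔.⊔-lub (proj₁ (q∈A k)) (proj₁ (q∈B k)) ,
      ⊓.⊓-glb (proj₂ (q∈A k)) (proj₂ (q∈B k)))
    where open IsDecTotalOrder isDecTotalOrder using () renaming (trans to ≤-trans)

  -- Truncation at 0 gives empty boxes volume 0.
  volume : Box → Carrier
  volume (box lo hi) = extent 0F * extent 1F * extent 2F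
    where
    extent : Fin 3 → Carrier
    extent k = 0# ⊔ᴿ (hi k - lo k)

  record Instance : Set (c ⊔ ℓ₁ ⊔ ℓ₂) where
    field
      n     : ℕ
      n>0   : n ℕ.> 0
      L W H : Carrier
      l w h : Fin n → Carrier
      L>0   : 0# < L
      W>0   : 0# < W
      H>0   : 0# < H
      l>0   : ∀ i → 0# < l i
      w>0   : ∀ i → 0# < w i
      h>0   : ∀ i → 0# < h i

  Orientation : Set
  Orientation = Fin 6

  module _ (I : Instance) where
    open Instance I

    record Placement : Set c where
      field
        orientation : Fin n → Orientation
        position    : Fin n → Point

    dimensions : Orientation → Fin n → Point
    dimensions 0F i = ⟨ l i , w i , h i ⟩
    dimensions 1F i = ⟨ l i , h i , w i ⟩
    dimensions 2F i = ⟨ w i , l i , h i ⟩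
    dimensions 3F i = ⟨ w i , h i , l i ⟩
    dimensions 4F i = ⟨ h i , l i , w i ⟩
    dimensions 5F i = ⟨ h i , w i , l i ⟩

    container : Box
    container = box ⟨ 0# , 0# , 0# ⟩ ⟨ L , W , H ⟩

    placed : Placement → Fin n → Box
    placed π i = box (position i) (λ k → position i k + dimensions (orientation i) i k)
      where open Placement π

    Feasible : Placement → Set (c ⊔ ℓ₁ ⊔ ℓ₂)
    Feasible π = (∀ i → placed π i ⊆ container)
               × (∀ i j → i ≢ j → volume (placed π i ∩ placed π j) ≈ 0#)

    parameters : List Carrier
    parameters = L ∷ W ∷ H ∷ concat (tabulate (λ i → l i ∷ w i ∷ h i ∷ []))

    -- Where the final state of the machine holds the output: the verdict in
    -- N₀ and, if it is 1, the orientation of item i in intMem[i] and its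
    -- position in realMem[3i], realMem[3i+1], realMem[3i+2] (i = 0, …, n-1).

    Outputs : State → Placement → Set ℓ₁
    Outputs s π = (∀ i → State.intMem s (toℕ i) ≡ toℕ (orientation i))
                × (∀ i k → State.realMem s (3 ℕ.* toℕ i ℕ.+ toℕ k) ≈ position i k)
      where open Placement π

    CorrectAnswer : State → Set (c ⊔ ℓ₁ ⊔ ℓ₂)
    CorrectAnswer s =
        (State.N s 0 ≡ 1 × ∃[ π ] Feasible π × Outputs s π)
      ⊎ (State.N s 0 ≡ 0 × ¬ (∃[ π ] Feasible π))

cuboidPacking : ∀ {c ℓ₁ ℓ₂ p} (R : RealNumbers c ℓ₁ ℓ₂ p) →
                Machine.Problem R (c ⊔ ℓ₁ ⊔ ℓ₂) (c ⊔ ℓ₁ ⊔ ℓ₂)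
cuboidPacking R = record
  { Input   = Instance
  ; size    = Instance.n
  ; params  = parameters
  ; Correct = CorrectAnswer
  }
  where open Packing R

{-# OPTIONS --safe #-}

module Submission where

-- A placement can be discretised: let the rank of a coordinate be the number of strictly
-- smaller coordinates among all 3n, whatever their axes, and round a coordinate of rank r down to the largest sum
-- of at most r input parameters below it.  On each axis, if item i ends before j starts, then i has
-- smaller rank than j, so the rounded position of i plus its side is a sum of at most
-- rank j parameters and therefore still lies below the rounded position of j.  Hence a
-- feasible placement exists iff one exists whose coordinates are sums of 3n parameters
-- (padded by 0), and there are finitely many of those.  They are numbered by natural
-- numbers in base 3n+4, whose digits give the orientations and the summands; the program
-- tries all these codes.

open import Defs
open import Algebra.Bundles using (CommutativeRing)
import Algebra.Construct.NaturalChoice.Max as Max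
import Algebra.Construct.NaturalChoice.Min as Min
import Algebra.Properties.AbelianGroup as AbelianGroupProperties
open import Data.Bool.Base using (true; false; if_then_else_)
open import Data.Fin.Base using (Fin; zero; suc; toℕ; fromℕ<)
open import Data.Fin.Patterns using (0F; 1F; 2F; 3F; 4F; 5F)
open import Data.Fin.Properties using (toℕ<n; toℕ-fromℕ<; toℕ-injective)
open import Data.List.Base using (List; []; _∷_; _++_; concat; tabulate)
open import Data.Maybe.Base using (maybe′)
open import Data.Nat.Base as ℕ
  using (ℕ; zero; suc; z≤n; s≤s; _≡ᵇ_; _^_; _≤′_; ≤′-refl; ≤′-step; NonZero)
open import Data.Nat.DivMod
open import Data.Nat.Divisibility using (n∣m*n)
open import Data.Nat.GeneralisedArithmetic using (iterate)
import Data.Nat.Properties as ℕ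
open import Data.Product.Base using (∃-syntax; _×_; _,_; proj₁; proj₂; map₂)
open import Data.Sum.Base using (_⊎_; inj₁; inj₂)
open import Function.Base using (_$_; _∘_; id)
open import Level using (Level; _⊔_)
open import Relation.Binary.Definitions using (tri<; tri≈; tri>)
open import Relation.Binary.PropositionalEquality
open import Relation.Binary.Structures using (IsDecTotalOrder)
open import Relation.Nullary using (¬_; Dec; yes; no; does; contradiction)

-- Two boxes with positive sides share volume 0 exactly if on some axis one ends no later than the
-- other begins. Feasibility is thus a finite combination of inequalities, and only the positions
-- range over an infinite set. With one fixed number of summands for all coordinates, a rounded
-- position plus a side could need one summand too many. The rank removes this obstacle: adding a
-- side costs one summand, and a positive side raises the rank by at least one. Strict growth and
-- the bound 3n are all that is asked of the rank, so a single count over all axes serves. The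
-- container is respected because rounding moves items towards the origin and 0 is itself a sum. The
-- base counts what a digit can address: three container sizes, 3n item sides and the zero cell
-- behind the input, which is the padding.

private variable
  a b a′ b′ : Level
  A : Set a

-- Digit expansions, orientations as permutations, memory offsets

module _ where
  open import Data.Nat.Base hiding (_⊔_)
  open import Data.Nat.Properties hiding (_≤?_)

  below-suc : ∀ {P : ℕ → Set a} {m} → P m → (∀ q → q < m → P q) → ∀ q → q < suc m → P q
  below-suc Pm below q q<1+m with m<1+n⇒m<n∨m≡n q<1+m
  ... | inj₁ q<m  = below q q<m
  ... | inj₂ refl = Pm

  module Digits (b : ℕ) .{{_ : NonZero b}} where

    shift : ℕ → ℕ → ℕ
    shift c zero    = c
    shift c (suc t) = shift c t / b

    digit : ℕ → ℕ → ℕ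
    digit c t = shift c t % b

    digit<b : ∀ c t → digit c t < b
    digit<b c t = m%n<n (shift c t) b

    -- `shift` divides last, like the loop that consumes its register, while the induction in
    -- `encode` strips the lowest digit first; both orders agree.
    shift-suc : ∀ c t → shift c (suc t) ≡ shift (c / b) t
    shift-suc c zero    = refl
    shift-suc c (suc t) = cong (_/ b) (shift-suc c t)

    [e+c*b]/b≡c : ∀ {e} c → e < b → (e + c * b) / b ≡ c
    [e+c*b]/b≡c {e} c e<b = begin
      (e + c * b) / b      ≡⟨ +-distrib-/-∣ʳ e (n∣m*n c) ⟩
      e / b + c * b / b    ≡⟨ cong₂ _+_ (m<n⇒m/n≡0 e<b) (m*n/n≡m c b) ⟩
      c                    ∎
      where open ≡-Reasoning

    [e+c*b]%b≡e : ∀ {e} c → e < b → (e + c * b) % b ≡ e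
    [e+c*b]%b≡e {e} c e<b = trans ([m+kn]%n≡m%n e c b) (m<n⇒m%n≡m e<b)

    -- Horner's scheme from the lowest digit: the remainder is `f 0` and the quotient encodes the
    -- tail. It numbers both the candidate placements and, in `round`, the sums over which a maximum
    -- is taken.
    encode : ∀ D (f : ℕ → ℕ) → (∀ t → f t < b) →
             ∃[ c ] c < b ^ D × (∀ t → t < D → digit c t ≡ f t)
    encode zero    f f<b = 0 , s≤s z≤n , λ _ ()
    encode (suc D) f f<b with encode D (λ t → f (suc t)) (λ t → f<b (suc t))
    ... | c , c<b^D , digits = f 0 + c * b , bound , digits′
      where
      bound : f 0 + c * b < b * b ^ D
      bound = begin-strict
        f 0 + c * b  <⟨ +-monoˡ-< (c * b) (f<b 0) ⟩
        suc c * b    ≤⟨ *-monoˡ-≤ b c<b^D ⟩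
        b ^ D * b    ≡⟨ *-comm (b ^ D) b ⟩
        b * b ^ D    ∎
        where open ≤-Reasoning
      digits′ : ∀ t → t < suc D → digit (f 0 + c * b) t ≡ f t
      digits′ zero    _         = [e+c*b]%b≡e c (f<b 0)
      digits′ (suc t) (s≤s t<D) = begin
        shift (f 0 + c * b) (suc t) % b     ≡⟨ cong (_% b) (shift-suc _ t) ⟩
        shift ((f 0 + c * b) / b) t % b     ≡⟨ cong (λ c → shift c t % b) ([e+c*b]/b≡c c (f<b 0)) ⟩
        digit c t                           ≡⟨ digits t t<D ⟩
        f (suc t)                           ∎
        where open ≡-Reasoning

  -- Under orientation o, axis k carries side number perm o k among (l , w , h).
  perm : ℕ → ℕ → ℕ
  perm o 0             = o / 2
  perm o 1             = (o + 1 + o / 3) % 3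
  perm o (suc (suc _)) = 3 ∸ o / 2 ∸ (o + 1 + o / 3) % 3

  perm<3 : ∀ {o} k → o < 6 → perm o k < 3
  perm<3 {o} 0 o<6 = m<n*o⇒m/o<n o<6
  perm<3 {o} 1 o<6 = m%n<n (o + 1 + o / 3) 3
  perm<3 {0} (suc (suc _)) _ = s≤s (s≤s (s≤s z≤n))
  perm<3 {1} (suc (suc _)) _ = s≤s (s≤s z≤n)
  perm<3 {2} (suc (suc _)) _ = s≤s (s≤s (s≤s z≤n))
  perm<3 {3} (suc (suc _)) _ = s≤s z≤n
  perm<3 {4} (suc (suc _)) _ = s≤s (s≤s z≤n)
  perm<3 {5} (suc (suc _)) _ = s≤s z≤n
  perm<3 {suc (suc (suc (suc (suc (suc _)))))} (suc (suc _)) (s≤s (s≤s (s≤s (s≤s (s≤s (s≤s ()))))))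

  slot<3n : ∀ {n i k} → i < n → k < 3 → 3 * i + k < 3 * n
  slot<3n {n} {i} {k} i<n k<3 = begin-strict
    3 * i + k <⟨ +-monoʳ-< (3 * i) k<3 ⟩
    3 * i + 3 ≡⟨ +-comm (3 * i) 3 ⟩
    3 + 3 * i ≡⟨ *-suc 3 i ⟨
    3 * suc i ≤⟨ *-monoʳ-≤ 3 i<n ⟩
    3 * n     ∎
    where open ≤-Reasoning

  slot-< : ∀ {i j k l} → i < j → k < 3 → 3 * i + k < 3 * j + l
  slot-< {j = j} {l = l} i<j k<3 = <-≤-trans (slot<3n i<j k<3) (m≤m+n (3 * j) l)

  prefix : ∀ {n} → (Fin n → ℕ) → (ℕ → ℕ) → ℕ → ℕ
  prefix {zero}  f g t       = g t
  prefix {suc n} f g zero    = f zero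
  prefix {suc n} f g (suc t) = prefix (f ∘ suc) g t

  prefix-toℕ : ∀ {n} (f : Fin n → ℕ) g i → prefix f g (toℕ i) ≡ f i
  prefix-toℕ f g zero    = refl
  prefix-toℕ f g (suc i) = prefix-toℕ (f ∘ suc) g i

  prefix-+ : ∀ {n} (f : Fin n → ℕ) g t → prefix f g (n + t) ≡ g t
  prefix-+ {zero}  f g t = refl
  prefix-+ {suc n} f g t = prefix-+ (f ∘ suc) g t

  prefix-< : ∀ {n b} (f : Fin n → ℕ) g → (∀ i → f i < b) → (∀ t → g t < b) →
             ∀ t → prefix f g t < b
  prefix-< {zero}  f g f<b g<b t       = g<b t
  prefix-< {suc n} f g f<b g<b zero    = f<b zero
  prefix-< {suc n} f g f<b g<b (suc t) = prefix-< (f ∘ suc) g (f<b ∘ suc) g<b t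

  slot-elim : ∀ {a n} {P : ℕ → Set a} → (∀ (i : Fin n) (k : Fin 3) → P (3 * toℕ i + toℕ k)) →
              ∀ p → p < 3 * n → P p
  slot-elim {n = n} {P} at p p<3n = subst P p≡ (at (fromℕ< q<n) (fromℕ< r<3))
    where
    q<n : p / 3 < n
    q<n = m<n*o⇒m/o<n (subst (p <_) (*-comm 3 n) p<3n)
    r<3 : p % 3 < 3
    r<3 = m%n<n p 3
    p≡ : 3 * toℕ (fromℕ< q<n) + toℕ (fromℕ< r<3) ≡ p
    p≡ = begin
      3 * toℕ (fromℕ< q<n) + toℕ (fromℕ< r<3)
        ≡⟨ cong₂ (λ q r → 3 * q + r) (toℕ-fromℕ< q<n) (toℕ-fromℕ< r<3) ⟩
      3 * (p / 3) + p % 3  ≡⟨ +-comm (3 * (p / 3)) (p % 3) ⟩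
      p % 3 + 3 * (p / 3)  ≡⟨ cong (p % 3 +_) (*-comm 3 (p / 3)) ⟩
      p % 3 + p / 3 * 3    ≡⟨ m≡m%n+[m/n]*n p 3 ⟨
      p                        ∎
      where open ≡-Reasoning

  ≔-same : ∀ (f : ℕ → A) i v → (f [ i ≔ v ]) i ≡ v
  ≔-same f i v with i ≡ᵇ i | ≡⇒≡ᵇ i i refl
  ... | true | _ = refl

  ≔-other : ∀ (f : ℕ → A) {i j} v → j ≢ i → (f [ i ≔ v ]) j ≡ f j
  ≔-other f {i} {j} v j≢i with j ≡ᵇ i | ≡ᵇ⇒≡ j i
  ... | true  | j≡i = contradiction (j≡i _) j≢i
  ... | false | _   = refl

-- Verdict flags and the program

Flag : ℕ → Set a → Set b → Set (a ⊔ b)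
Flag v A B = (v ≡ 0 × A) ⊎ (v ≡ 1 × B)

flag-map : ∀ {v} {A : Set a} {A′ : Set a′} {B : Set b} {B′ : Set b′} →
           (A → A′) → (B → B′) → Flag v A B → Flag v A′ B′
flag-map f g (inj₁ (v≡0 , a)) = inj₁ (v≡0 , f a)
flag-map f g (inj₂ (v≡1 , b)) = inj₂ (v≡1 , g b)

-- Registers: N₀, …, N₆ hold n, 1, B = 3n+4, 2B, 3n, 3, 6; N₇ the number of codes, N₈ the
-- current code, N₉ whether a feasible code was found, N₁₀ the part of the code that is not
-- decoded yet, N₁₁ whether the check failed; N₁₂, N₁₃, N₁₄ are loop counters.
-- Real memory: positions from 0, a copy of the input (with a trailing 0) from B, and the
-- sides of the rotated items from 2B; axis k of item i has offset 3i+k.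

increment : ℕ → Program
increment i = intOp add i i 1 ∷ []

copyBody scaleBody permBody orientBody sumBody coordBody
  axisBody pairBody rowBody insideBody : Program

copyBody =
  intOp add 15 2 12 ∷ realLoad 0 12 ∷ realStore 15 0 ∷ increment 12

scaleBody = intOp mul 7 2 7 ∷ increment 12

setup : Program
setup =
  intConst 1 1 ∷ intConst 5 3 ∷ intConst 6 6 ∷ intConst 15 4 ∷
  intOp mul 4 5 0 ∷ intOp add 2 15 4 ∷ intOp add 3 2 2 ∷
  intConst 12 0 ∷ while (N<N 12 2) copyBody ∷
  -- One digit per item, and 3n summands for each of the 3n coordinates.
  intOp mul 15 4 4 ∷ intOp add 16 0 15 ∷ intConst 7 1 ∷
  intConst 12 0 ∷ while (N<N 12 16) scaleBody ∷
  intConst 9 0 ∷ []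

permBody =
  intOp rem 15 10 2 ∷ intOp quo 10 10 2 ∷
  -- Reduction modulo 6 turns any digit into an orientation, so that no code is invalid.
  intOp rem 15 15 6 ∷ intStore 12 15 ∷
  intConst 20 2 ∷ intOp quo 16 15 20 ∷
  intOp quo 17 15 5 ∷ intOp add 18 15 1 ∷ intOp add 17 18 17 ∷ intOp rem 17 17 5 ∷
  intOp monus 18 5 16 ∷ intOp monus 18 18 17 ∷
  intOp mul 19 5 12 ∷ []

-- `k` is the axis, and `r` the register that says which of the three sides of the item lies along
-- it.
sideBody : ℕ → ℕ → Program
sideBody k r =
  intOp add 15 19 r ∷ intOp add 15 5 15 ∷ intOp add 15 2 15 ∷ realLoad 0 15 ∷
  intConst 20 k ∷ intOp add 20 19 20 ∷ intOp add 20 3 20 ∷ realStore 20 0 ∷ []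

orientBody =
  permBody ++ sideBody 0 16 ++ sideBody 1 17 ++ sideBody 2 18 ++ increment 12

sumBody =
  intOp rem 15 10 2 ∷ intOp quo 10 10 2 ∷
  intOp add 15 2 15 ∷ realLoad 1 15 ∷ realOp add 0 0 1 ∷
  increment 13

coordBody =
  realZero 0 ∷ intConst 13 0 ∷ while (N<N 13 4) sumBody ∷
  realStore 12 0 ∷ increment 12

fail : Program
fail = intConst 11 1 ∷ []

insideBody =
  realLoad 0 12 ∷ realZero 1 ∷ branch (X≤X 1 0) [] fail ∷
  intOp add 15 3 12 ∷ realLoad 1 15 ∷ realOp add 0 0 1 ∷
  -- The offset modulo 3 is the axis, and the copied input begins with the three container sizes.
  intOp rem 15 12 5 ∷ intOp add 15 2 15 ∷ realLoad 1 15 ∷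
  branch (X≤X 0 1) [] fail ∷
  increment 12

axisBody =
  intOp mul 15 5 12 ∷ intOp add 15 15 14 ∷
  intOp mul 16 5 13 ∷ intOp add 16 16 14 ∷
  realLoad 0 15 ∷ realLoad 1 16 ∷
  intOp add 15 3 15 ∷ intOp add 16 3 16 ∷
  realLoad 2 15 ∷ realOp add 2 0 2 ∷
  realLoad 3 16 ∷ realOp add 3 1 3 ∷
  -- Register 17 stays 1 once some axis separates the pair, in either order.
  branch (X≤X 2 1) (intConst 17 1 ∷ []) [] ∷
  branch (X≤X 3 0) (intConst 17 1 ∷ []) [] ∷
  increment 14

pairBody =
  intConst 17 0 ∷ intConst 14 0 ∷ while (N<N 14 5) axisBody ∷
  branch (N<N 17 1) fail [] ∷
  increment 13

rowBody = intConst 13 0 ∷ while (N<N 13 12) pairBody ∷ increment 12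

decode check codeBody search packing : Program

decode =
  -- A register move is written as `0 + v`, which reduces to `v`.
  intConst 15 0 ∷ intOp add 10 15 8 ∷
  intConst 12 0 ∷ while (N<N 12 0) orientBody ∷
  intConst 12 0 ∷ while (N<N 12 4) coordBody ∷ []

check =
  intConst 11 0 ∷
  intConst 12 0 ∷ while (N<N 12 4) insideBody ∷
  intConst 12 0 ∷ while (N<N 12 0) rowBody ∷ []

codeBody =
  -- After a success the remaining rounds only advance the counter, so both memories keep the
  -- placement that was found.
  branch (N<N 9 1)
    (decode ++ check ++ branch (N<N 11 1) (intConst 9 1 ∷ []) [] ∷ [])
    [] ∷
  increment 8

search = intConst 8 0 ∷ while (N<N 8 7) codeBody ∷ []

packing = setup ++ search ++ intConst 15 0 ∷ intOp add 0 15 9 ∷ []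

-- Ordered field arithmetic

module OrderedField {c ℓ₁ ℓ₂ p} (R : RealNumbers c ℓ₁ ℓ₂ p) where
  open RealNumbers R
  open CommutativeRing commutativeRing public
    using (+-cong; +-congˡ; +-congʳ; +-comm; +-identityˡ; +-identityʳ;
           *-congˡ; *-congʳ; *-assoc; *-comm; *-identityˡ; zeroˡ; zeroʳ;
           -‿inverseʳ; +-abelianGroup)
    renaming (refl to ≈-refl; sym to ≈-sym; trans to ≈-trans; reflexive to ≡⇒≈)
  open IsDecTotalOrder isDecTotalOrder public
    using (antisym; total)
    renaming (refl to ≤-refl; reflexive to ≤-reflexive; trans to ≤-trans)
  open AbelianGroupProperties +-abelianGroup using (//-rightDividesˡ; //-rightDividesʳ)

  ≤-resp₂ : ∀ {x x′ y y′} → x ≈ x′ → y ≈ y′ → x ≤ y → x′ ≤ y′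
  ≤-resp₂ x≈x′ y≈y′ x≤y = ≤-trans (≤-reflexive (≈-sym x≈x′)) (≤-trans x≤y (≤-reflexive y≈y′))

  x≤x+y : ∀ x {y} → 0# ≤ y → x ≤ x + y
  x≤x+y x {y} 0≤y = ≤-resp₂ (+-identityˡ x) (+-comm y x) (+-monoˡ-≤ x 0≤y)

  x+y≤x⇒y≤0 : ∀ x {y} → x + y ≤ x → y ≤ 0#
  x+y≤x⇒y≤0 x {y} x+y≤x =
    ≤-resp₂ (≈-trans (+-congʳ (+-comm x y)) (//-rightDividesʳ x y)) (-‿inverseʳ x) (+-monoˡ-≤ (- x) x+y≤x)

  x-y≤0⇒x≤y : ∀ {x y} → x - y ≤ 0# → x ≤ y
  x-y≤0⇒x≤y {x} {y} x-y≤0 = ≤-resp₂ (//-rightDividesˡ y x) (+-identityˡ y) (+-monoˡ-≤ y x-y≤0)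

  x≤y⇒x-y≤0 : ∀ {x y} → x ≤ y → x - y ≤ 0#
  x≤y⇒x-y≤0 {x} {y} x≤y = ≤-resp₂ ≈-refl (-‿inverseʳ y) (+-monoˡ-≤ (- y) x≤y)

  x*y≈0⇒x≈0∨y≈0 : ∀ x y → x * y ≈ 0# → x ≈ 0# ⊎ y ≈ 0#
  x*y≈0⇒x≈0∨y≈0 x y xy≈0 with x ≟ 0#
  ... | yes x≈0 = inj₁ x≈0
  ... | no x≉0 with inverse x x≉0
  ...   | z , xz≈1 = inj₂ (≈-trans (≈-sym (*-identityˡ y)) (≈-trans (*-congʳ (≈-sym (≈-trans (*-comm z x) xz≈1)))
            (≈-trans (*-assoc z x y) (≈-trans (*-congˡ xy≈0) (zeroʳ z)))))

-- Feasibility as inequalities between coordinates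

module Geometry {c ℓ₁ ℓ₂ p} (R : RealNumbers c ℓ₁ ℓ₂ p) (I : Packing.Instance R) where
  open RealNumbers R
  open OrderedField R
  open Packing R
  open Instance I
  private
    module ⊓ = Min totalOrder
    module ⊔ = Max totalOrder

  sizes : Point
  sizes = ⟨ L , W , H ⟩

  side : Placement I → Fin n → Point
  side π i = dimensions I (Placement.orientation π i) i

  private
    ⟨⟩>0 : ∀ {x y z} → 0# < x → 0# < y → 0# < z → ∀ k → 0# < ⟨ x , y , z ⟩ k
    ⟨⟩>0 x>0 y>0 z>0 0F = x>0
    ⟨⟩>0 x>0 y>0 z>0 1F = y>0
    ⟨⟩>0 x>0 y>0 z>0 2F = z>0

  dimensions>0 : ∀ o i k → 0# < dimensions I o i k
  dimensions>0 0F i = ⟨⟩>0 (l>0 i) (w>0 i) (h>0 i)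
  dimensions>0 1F i = ⟨⟩>0 (l>0 i) (h>0 i) (w>0 i)
  dimensions>0 2F i = ⟨⟩>0 (w>0 i) (l>0 i) (h>0 i)
  dimensions>0 3F i = ⟨⟩>0 (w>0 i) (h>0 i) (l>0 i)
  dimensions>0 4F i = ⟨⟩>0 (h>0 i) (l>0 i) (w>0 i)
  dimensions>0 5F i = ⟨⟩>0 (h>0 i) (w>0 i) (l>0 i)

  origin : Point
  origin = ⟨ 0# , 0# , 0# ⟩

  origin≡0 : ∀ k → origin k ≡ 0#
  origin≡0 0F = refl
  origin≡0 1F = refl
  origin≡0 2F = refl

  private
    extent : Box → Fin 3 → Carrier
    extent (box lo hi) k = 0# ⊔.⊔ (hi k - lo k)

  volume≈0⇒extent≈0 : ∀ A → volume A ≈ 0# → ∃[ k ] extent A k ≈ 0#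
  volume≈0⇒extent≈0 A vol≈0 with x*y≈0⇒x≈0∨y≈0 _ _ vol≈0
  ... | inj₂ e₂ = 2F , e₂
  ... | inj₁ e₀₁ with x*y≈0⇒x≈0∨y≈0 _ _ e₀₁
  ...   | inj₁ e₀ = 0F , e₀
  ...   | inj₂ e₁ = 1F , e₁

  extent≈0⇒volume≈0 : ∀ A k → extent A k ≈ 0# → volume A ≈ 0#
  extent≈0⇒volume≈0 A 0F e = ≈-trans (*-congʳ (≈-trans (*-congʳ e) (zeroˡ _))) (zeroˡ _)
  extent≈0⇒volume≈0 A 1F e = ≈-trans (*-congʳ (≈-trans (*-congˡ e) (zeroʳ _))) (zeroˡ _)
  extent≈0⇒volume≈0 A 2F e = ≈-trans (*-congˡ e) (zeroʳ _)

  extent≈0⇒hi≤lo : ∀ A k → extent A k ≈ 0# → Box.hi A k ≤ Box.lo A k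
  extent≈0⇒hi≤lo A k e = x-y≤0⇒x≤y (≤-trans (⊔.x≤y⊔x 0# _) (≤-reflexive e))

  hi≤lo⇒extent≈0 : ∀ A k → Box.hi A k ≤ Box.lo A k → extent A k ≈ 0#
  hi≤lo⇒extent≈0 A k hi≤lo = antisym (⊔.⊔-lub ≤-refl (x≤y⇒x-y≤0 hi≤lo)) (⊔.x≤x⊔y 0# _)

  module _ (π : Placement I) where
    open Placement π

    SeparatedOn : Fin n → Fin n → Fin 3 → Set ℓ₂
    SeparatedOn i j k = position i k + side π i k ≤ position j k
                      ⊎ position j k + side π j k ≤ position i k

    Separated : Fin n → Fin n → Set ℓ₂
    Separated i j = ∃[ k ] SeparatedOn i j k

    Contained : Fin n → Set ℓ₂
    Contained i = ∀ k → 0# ≤ position i k × position i k + side π i k ≤ sizes k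

    private
      end≰start : ∀ i k → ¬ position i k + side π i k ≤ position i k
      end≰start i k end≤start with dimensions>0 (orientation i) i k
      ... | 0≤d , 0≉d = 0≉d (antisym 0≤d (x+y≤x⇒y≤0 _ end≤start))

      start≤end : ∀ i k → position i k ≤ position i k + side π i k
      start≤end i k = x≤x+y _ (proj₁ (dimensions>0 (orientation i) i k))

    separated⇒disjoint : ∀ {i j} → Separated i j → volume (placed I π i ∩ placed I π j) ≈ 0#
    separated⇒disjoint {i} {j} (k , separated) =
      extent≈0⇒volume≈0 common k (hi≤lo⇒extent≈0 common k (hi≤lo separated))
      where
      common : Box
      common = placed I π i ∩ placed I π j
      hi≤lo : SeparatedOn i j k → Box.hi common k ≤ Box.lo common k
      hi≤lo (inj₁ i≤j) = ≤-trans (⊓.x⊓y≤x _ _) (≤-trans i≤j (⊔.x≤y⊔x _ _))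
      hi≤lo (inj₂ j≤i) = ≤-trans (⊓.x⊓y≤y _ _) (≤-trans j≤i (⊔.x≤x⊔y _ _))

    -- On an axis of extent 0 the smaller end is at most the larger start. If both came from the
    -- same item, its side would not be positive; so they come from different items, which is
    -- separation.
    disjoint⇒separated : ∀ {i j} → volume (placed I π i ∩ placed I π j) ≈ 0# → Separated i j
    disjoint⇒separated {i} {j} vol≈0 with volume≈0⇒extent≈0 (placed I π i ∩ placed I π j) vol≈0
    ... | k , e with extent≈0⇒hi≤lo (placed I π i ∩ placed I π j) k e
                   | ⊓.⊓-sel (position i k + side π i k) (position j k + side π j k)
                   | ⊔.⊔-sel (position i k) (position j k)
    ... | hi≤lo | inj₁ hi≈ | inj₁ lo≈ = contradiction (≤-resp₂ hi≈ lo≈ hi≤lo) (end≰start i k)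
    ... | hi≤lo | inj₁ hi≈ | inj₂ lo≈ = k , inj₁ (≤-resp₂ hi≈ lo≈ hi≤lo)
    ... | hi≤lo | inj₂ hi≈ | inj₁ lo≈ = k , inj₂ (≤-resp₂ hi≈ lo≈ hi≤lo)
    ... | hi≤lo | inj₂ hi≈ | inj₂ lo≈ = contradiction (≤-resp₂ hi≈ lo≈ hi≤lo) (end≰start j k)

    contained⇒⊆ : ∀ {i} → Contained i → placed I π i ⊆ container I
    contained⇒⊆ contained q q∈ k =
      ≤-trans (≤-reflexive (≡⇒≈ (origin≡0 k))) (≤-trans (proj₁ (contained k)) (proj₁ (q∈ k))) ,
      ≤-trans (proj₂ (q∈ k)) (proj₂ (contained k))

    -- Inclusion is tested at the lowest and the highest corner, which belong to the box because its
    -- sides are nonnegative.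
    ⊆⇒contained : ∀ {i} → placed I π i ⊆ container I → Contained i
    ⊆⇒contained {i} i⊆ k =
      ≤-trans (≤-reflexive (≈-sym (≡⇒≈ (origin≡0 k))))
              (proj₁ (i⊆ (position i) (λ k → ≤-refl , start≤end i k) k)) ,
      proj₂ (i⊆ (λ k → position i k + side π i k) (λ k → start≤end i k , ≤-refl) k)

-- Runs of the machine and a rule for counting loops

module Execution {c ℓ₁ ℓ₂ p} (R : RealNumbers c ℓ₁ ℓ₂ p) where
  open import Data.Nat.Base hiding (_⊔_)
  open import Data.Nat.Properties hiding (_≤?_)
  open RealNumbers R using (Carrier; _≤?_) renaming (_≤_ to _≤ᴿ_)
  open Machine R public

  -- A run up to the moment when exactly `k` is left. Specifications quantified over `k` describe a
  -- block in any context and compose by `>>=`; halting is the case `k = []`.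
  Reach : ∀ {q} → Config → Program → (State → Set q) → Set (c ⊔ q)
  Reach κ k Post = ∃[ s ] (∃[ t ] iterate step κ t ≡ (k , s)) × Post s

  private variable
    q q′ : Level
    k k₁ : Program
    s : State
    κ : Config
    Post Post′ : State → Set q

  done : Post s → Reach (k , s) k Post
  done post = _ , (0 , refl) , post

  -- On explicit instructions `iterate step κ t` reduces, which gives symbolic execution. Other
  -- rules are needed only where reduction is stuck: at tests and at division by a register of
  -- unknown value.
  steps : ∀ t → Reach (iterate step κ t) k Post → Reach κ k Post
  steps zero    r = r
  steps (suc t) r with steps t r
  ... | s , (t′ , eq) , post = s , (suc t′ , eq) , post

  _>>=_ : Reach κ k₁ Post → (∀ {s} → Post s → Reach (k₁ , s) k Post′) →
          Reach κ k Post′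
  (s , (t , eq) , post) >>= f = steps t (subst (λ κ → Reach κ _ _) (sym eq) (f post))

  quo-step : ∀ {d a b m N X I M} → N b ≡ suc m →
             Reach (k₁ , state (N [ d ≔ N a / suc m ]) X I M) k Post →
             Reach (intOp quo d a b ∷ k₁ , state N X I M) k Post
  quo-step {k₁ = k₁} {d = d} {a} {b} {N = N} {X} {I} {M} eq (s , (t , run) , post) =
    s , (suc t , trans (cong (λ v → iterate step (maybe′ (λ m → k₁ , state (N [ d ≔ m ]) X I M)
                                    (intOp quo d a b ∷ k₁ , state N X I M)
                                    (evalInt quo (N a) v)) t) eq) run) , post

  rem-step : ∀ {d a b m N X I M} → N b ≡ suc m →
             Reach (k₁ , state (N [ d ≔ N a % suc m ]) X I M) k Post →
             Reach (intOp rem d a b ∷ k₁ , state N X I M) k Post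
  rem-step {k₁ = k₁} {d = d} {a} {b} {N = N} {X} {I} {M} eq (s , (t , run) , post) =
    s , (suc t , trans (cong (λ v → iterate step (maybe′ (λ m → k₁ , state (N [ d ≔ m ]) X I M)
                                    (intOp rem d a b ∷ k₁ , state N X I M)
                                    (evalInt rem (N a) v)) t) eq) run) , post

  private
    if-true : ∀ {κ₁ κ₂ : Program} {B : Set q′} (d : Dec B) → B → Reach (κ₁ , s) k Post →
              Reach ((if does d then κ₁ else κ₂) , s) k Post
    if-true (yes _) _ r = r
    if-true (no ¬b) b _ = contradiction b ¬b

    if-false : ∀ {κ₁ κ₂ : Program} {B : Set q′} (d : Dec B) → ¬ B → Reach (κ₂ , s) k Post →
               Reach ((if does d then κ₁ else κ₂) , s) k Post
    if-false (yes b) ¬b _ = contradiction b ¬b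
    if-false (no _)  _  r = r

    if-++ : ∀ {P Q : Program} {B : Set q′} (d : Dec B) →
            (B → Reach (P ++ k₁ , s) k Post) → (¬ B → Reach (Q ++ k₁ , s) k Post) →
            Reach ((if does d then P else Q) ++ k₁ , s) k Post
    if-++ (yes b) f g = f b
    if-++ (no ¬b) f g = g ¬b

  branch-N : ∀ {i j P Q N X I M} →
             (N i < N j → Reach (P ++ k₁ , state N X I M) k Post) →
             (¬ N i < N j → Reach (Q ++ k₁ , state N X I M) k Post) →
             Reach (branch (N<N i j) P Q ∷ k₁ , state N X I M) k Post
  branch-N {i = i} {j} {N = N} f g = steps 1 (if-++ (N i <? N j) f g)

  branch-X : ∀ {i j P Q N X I M} →
             (X i ≤ᴿ X j → Reach (P ++ k₁ , state N X I M) k Post) →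
             (¬ X i ≤ᴿ X j → Reach (Q ++ k₁ , state N X I M) k Post) →
             Reach (branch (X≤X i j) P Q ∷ k₁ , state N X I M) k Post
  branch-X {i = i} {j} {X = X} f g = steps 1 (if-++ (X i ≤? X j) f g)

  -- The invariant carries the round number, which `bounds` ties to the counter register; this
  -- decides every test, and the recursion is on the rounds left. The body is asked to work before
  -- any continuation, because the loop itself follows it.
  while-rule : ∀ {i b m P} (Inv : ℕ → State → Set q) →
    (∀ j {s} → Inv j s → State.N s i ≡ j × State.N s b ≡ m) →
    (∀ j {s} → j < m → Inv j s → ∀ {k} → Reach (P ++ k , s) k (Inv (suc j))) →
    Inv 0 s → Reach (while (N<N i b) P ∷ k , s) k (Inv m)
  while-rule {k = k} {i = i} {b} {m} {P} Inv bounds body = go m (+-identityʳ m)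
    where
    go : ∀ r {j s} → r + j ≡ m → Inv j s →
         Reach (while (N<N i b) P ∷ k , s) k (Inv m)
    go zero {s = s} refl inv with bounds _ inv
    ... | refl , Nb≡m = steps 1 (if-false (State.N s i <? State.N s b)
      (λ i<b → <-irrefl (sym Nb≡m) i<b) (done inv))
    go (suc r) {j} {s} r+j≡m inv with bounds _ inv
    ... | Ni≡j , Nb≡m = steps 1 (if-true (State.N s i <? State.N s b)
      (subst₂ _<_ (sym Ni≡j) (sym Nb≡m) j<m)
      (body j j<m inv >>= go r (trans (+-suc r j) r+j≡m)))
      where
      j<m : j < m
      j<m = subst (j <_) r+j≡m (s≤s (m≤n+m j r))

-- Layout of codes and memory during the search

module Search {c ℓ₁ ℓ₂ p} (R : RealNumbers c ℓ₁ ℓ₂ p)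
              (n : ℕ) (parameters : List (RealNumbers.Carrier R)) where
  open import Data.Nat.Base hiding (_⊔_)
  open import Data.Nat.Properties hiding (_≤?_)
  open RealNumbers R using (Carrier; 0#) renaming (_+_ to _+ᴿ_; _≤_ to _≤ᴿ_)
  open Execution R

  base slots codes : ℕ
  slots = 3 * n
  base  = 4 + slots
  codes = base ^ (n + slots * slots)

  open Digits base

  parameter : ℕ → Carrier
  parameter = memory parameters

  orientationOf : ℕ → ℕ → ℕ
  orientationOf code i = digit code i % 6

  sideOf : ℕ → ℕ → ℕ → ℕ
  sideOf o i k = 3 + (3 * i + perm o k)

  parameterSum : (ℕ → ℕ) → ℕ → Carrier
  parameterSum g zero    = 0#
  parameterSum g (suc t) = parameterSum g t +ᴿ parameter (g t)

  -- The lowest `n` digits are orientations; then each coordinate owns a block of `slots` digits.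
  -- With `t` in front, the next index is definitionally a successor and matches one more division
  -- of the code register.
  coordinateOf : ℕ → ℕ → Carrier
  coordinateOf code p = parameterSum (λ t → digit code (t + (p * slots + n))) slots

  Sizes : (ℕ → ℕ) → Set
  Sizes N =
    N 0 ≡ n × N 1 ≡ 1 × N 2 ≡ base × N 3 ≡ base + base × N 4 ≡ slots × N 5 ≡ 3 × N 6 ≡ 6

  -- The last entry can be fixed at 0 because codes are decoded and checked only while none has been
  -- found.
  Constants : ℕ → (ℕ → ℕ) → Set
  Constants code N = Sizes N × N 7 ≡ codes × N 8 ≡ code × N 9 ≡ 0

  Copied : (ℕ → Carrier) → Set c
  Copied M = ∀ e → e < base → M (base + e) ≡ parameter e

  Oriented : ℕ → ℕ → (ℕ → ℕ) → Set
  Oriented code i I = ∀ j → j < i → I j ≡ orientationOf code j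

  SideAt : ℕ → (ℕ → Carrier) → ℕ → ℕ → Set c
  SideAt code M i k =
    M (base + base + (3 * i + k)) ≡ parameter (sideOf (orientationOf code i) i k)

  -- The second part describes the item in progress, whose sides are written one axis at a time;
  -- between items `l` is 0.
  Sided : ℕ → ℕ → ℕ → (ℕ → Carrier) → Set c
  Sided code i l M =
    (∀ j k → j < i → k < 3 → SideAt code M j k) × (∀ k → k < l → SideAt code M i k)

  Located : ℕ → ℕ → (ℕ → Carrier) → Set c
  Located code p M = ∀ q → q < p → M q ≡ coordinateOf code q

  sideOf<base : ∀ {o i k} → o < 6 → i < n → sideOf o i k < base
  sideOf<base {o} {i} {k} o<6 i<n = s≤s (s≤s (s≤s (m≤n⇒m≤1+n (slot<3n i<n (perm<3 {o} k o<6)))))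

  -- Decoding a code

  OrientInv : ℕ → ℕ → State → Set c
  OrientInv code i (state N X I M) =
    Constants code N × N 12 ≡ i × N 10 ≡ shift code i × Copied M ×
    Oriented code i I × Sided code i 0 M

  SideInv : ℕ → ℕ → ℕ → State → Set c
  SideInv code i l (state N X I M) =
    Constants code N × N 12 ≡ i × N 10 ≡ shift code (suc i) ×
    N 19 ≡ 3 * i × N 16 ≡ perm o 0 × N 17 ≡ perm o 1 × N 18 ≡ perm o 2 × Copied M ×
    Oriented code (suc i) I × Sided code i l M
    where o = orientationOf code i

  copied-≔ : ∀ {M a v} → Copied M → (∀ e → e < base → base + e ≢ a) → Copied (M [ a ≔ v ])
  copied-≔ {M} copied a≢ e e<b = trans (≔-other M _ (a≢ e e<b)) (copied e e<b)

  side≢copy : ∀ {a u} → a ≡ base + base + u → ∀ e → e < base → base + e ≢ a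
  side≢copy {u = u} refl e e<b eq = <⇒≢
    (<-≤-trans (+-monoʳ-< base e<b) (m≤m+n (base + base) u)) eq

  -- Offsets are ordered lexicographically by item and axis, so the new cell lies beyond all sides
  -- written before.
  sided-≔ : ∀ {code M a v i l} → a ≡ base + base + (3 * i + l) →
    v ≡ parameter (sideOf (orientationOf code i) i l) →
    Sided code i l M → Sided code i (suc l) (M [ a ≔ v ])
  sided-≔ {code} {M} {a} {v} {i} {l} refl v≡ (earlier , current) = earlier′ , current′
    where
    keep : ∀ j k → 3 * j + k < 3 * i + l → SideAt code M j k → SideAt code (M [ a ≔ v ]) j k
    keep j k <l = trans (≔-other M v (<⇒≢ (+-monoʳ-< (base + base) <l)))
    earlier′ : ∀ j k → j < i → k < 3 → SideAt code (M [ a ≔ v ]) j k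
    earlier′ j k j<i k<3 = keep j k (slot-< j<i k<3) (earlier j k j<i k<3)
    current′ : ∀ k → k < suc l → SideAt code (M [ a ≔ v ]) i k
    current′ = below-suc (trans (≔-same M a v) v≡) λ k k<l →
      keep i k (+-monoʳ-< (3 * i) k<l) (current k k<l)

  sided-suc : ∀ {code M i} → Sided code i 3 M → Sided code (suc i) 0 M
  sided-suc {code} {M} (earlier , current) =
    (λ j k j<1+i k<3 → below-suc {P = λ j → ∀ k → k < 3 → SideAt code M j k} current
      (λ j j<i k k<3 → earlier j k j<i k<3) j j<1+i k k<3) ,
    λ _ ()

  oriented-suc : ∀ {code I a v i} → a ≡ i → v ≡ orientationOf code i →
    Oriented code i I → Oriented code (suc i) (I [ a ≔ v ])
  oriented-suc {I = I} {v = v} {i} refl refl oriented =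
    below-suc (≔-same I i v) λ j j<i → trans (≔-other I v (<⇒≢ j<i)) (oriented j j<i)

  perm-step : ∀ {code} i {s} → OrientInv code i s → ∀ {k} →
              Reach (permBody ++ k , s) k (SideInv code i 0)
  perm-step {code} i {state N X I M}
    (consts@((_ , e1 , e2 , _ , _ , e5 , e6) , _) , e12 , e10 , copied , oriented , sided , _) =
    -- The division by 2 is among the plain steps: its divisor was just loaded as a literal, so it
    -- reduces by itself.
    rem-step e2 $ quo-step e2 $ rem-step e6 $ steps 3 $ quo-step e5 $ steps 2 $ rem-step e5 $ steps 3 $ done
      ( consts , e12 , cong (_/ base) e10 , cong₂ _*_ e5 e12
      , cong (λ o → perm o 0) o≡
      , cong₂ (λ t o → (o + t + o / 3) % 3) e1 o≡
      , trans (cong₂ (λ t u → t ∸ o / 2 ∸ (o + u + o / 3) % 3) e5 e1) (cong (λ o → perm o 2) o≡)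
      , copied , oriented-suc e12 o≡ oriented , sided , λ _ () )
    where
    o : ℕ
    o = (N 10 % base) % 6
    o≡ : o ≡ orientationOf code i
    o≡ = cong (λ w → (w % base) % 6) e10

  side-step : ∀ {code} i l r {s} → i < n → State.N s r ≡ perm (orientationOf code i) l →
              SideInv code i l s → ∀ {k} →
              Reach (sideBody l r ++ k , s) k (SideInv code i (suc l))
  side-step {code} i l r {state N X I M} i<n er
    (consts@((_ , _ , e2 , e3 , _ , e5 , _) , _) , e12 , e10 , e19 , e16 , e17 , e18 , copied , oriented , sided) =
    steps 8 $ done
      ( consts , e12 , e10 , e19 , e16 , e17 , e18 , copied-≔ {M} copied (side≢copy to)
      , oriented , sided-≔ {M = M} to from sided )
    where
    to : N 3 + (N 19 + l) ≡ base + base + (3 * i + l)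
    to = cong₂ (λ a b → a + (b + l)) e3 e19
    from : M (N 2 + (N 5 + (N 19 + N r))) ≡ parameter (sideOf (orientationOf code i) i l)
    from = trans (cong M (cong₂ _+_ e2 (cong₂ _+_ e5 (cong₂ _+_ e19 er))))
      (copied _ (sideOf<base {orientationOf code i} {i} {l} (m%n<n (digit code i) 6) i<n))

  orient-step : ∀ {code} i {s} → i < n → OrientInv code i s → ∀ {k} →
                Reach (orientBody ++ k , s) k (OrientInv code (suc i))
  orient-step i i<n inv =
    perm-step i inv >>= λ inv@(_ , _ , _ , _ , e16 , _) →
    side-step i 0 16 i<n e16 inv >>= λ inv@(_ , _ , _ , _ , _ , e17 , _) →
    side-step i 1 17 i<n e17 inv >>= λ inv@(_ , _ , _ , _ , _ , _ , e18 , _) →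
    side-step i 2 18 i<n e18 inv >>= λ {s}
      (consts@((_ , e1 , _) , _) , e12 , e10 , _ , _ , _ , _ , copied , oriented , sided) →
    steps 1 $ done
      ( consts , trans (cong₂ _+_ e12 e1) (+-comm i 1) , e10 , copied , oriented , sided-suc {M = State.realMem s} sided )

  copied-low : ∀ {M a v} → a < base → Copied M → Copied (M [ a ≔ v ])
  copied-low {M} {a} a<base copied =
    copied-≔ {M} copied λ e _ eq → <⇒≢ (<-≤-trans a<base (m≤m+n base e)) (sym eq)

  sided-low : ∀ {code M a v} → a < base → Sided code n 0 M → Sided code n 0 (M [ a ≔ v ])
  sided-low {code} {M} {a} {v} a<base (sided , _) = sided′ , λ _ ()
    where
    sided′ : ∀ j k → j < n → k < 3 → SideAt code (M [ a ≔ v ]) j k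
    sided′ j k j<n k<3 = trans
      (≔-other M v (λ eq → <⇒≢ (<-≤-trans a<base
        (≤-trans (m≤m+n base base) (m≤m+n (base + base) (3 * j + k)))) (sym eq)))
      (sided j k j<n k<3)

  located-≔ : ∀ {code M a v p} → a ≡ p → v ≡ coordinateOf code p →
              Located code p M → Located code (suc p) (M [ a ≔ v ])
  located-≔ {M = M} {v = v} {p} refl v≡ located =
    below-suc (trans (≔-same M p v) v≡) λ q q<p → trans (≔-other M v (<⇒≢ q<p)) (located q q<p)

  CoordInv : ℕ → ℕ → State → Set c
  CoordInv code p (state N X I M) =
    Constants code N × N 12 ≡ p × N 10 ≡ shift code (p * slots + n) × Copied M ×
    Oriented code n I × Sided code n 0 M × Located code p M

  SumInv : ℕ → ℕ → ℕ → State → Set c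
  SumInv code p t (state N X I M) =
    Constants code N × N 12 ≡ p × N 13 ≡ t ×
    N 10 ≡ shift code (t + (p * slots + n)) ×
    X 0 ≡ parameterSum (λ t → digit code (t + (p * slots + n))) t ×
    Copied M × Oriented code n I × Sided code n 0 M × Located code p M

  sum-step : ∀ {code p} t {s} → t < slots → SumInv code p t s → ∀ {k} →
             Reach (sumBody ++ k , s) k (SumInv code p (suc t))
  sum-step {code} {p} t {state N X I M} _
    (consts@((_ , e1 , e2 , _) , _) , e12 , e13 , e10 , sum , copied , rest) =
    rem-step e2 $ quo-step e2 $ steps 4 $ done
      ( consts , e12 , trans (cong₂ _+_ e13 e1) (+-comm t 1) , cong (_/ base) e10
      , cong₂ _+ᴿ_ sum (trans (cong M (cong₂ (λ b w → b + w % base) e2 e10))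
                              (copied _ (digit<b code (t + (p * slots + n)))))
      , copied , rest )

  coord-step : ∀ {code} p {s} → p < slots → CoordInv code p s → ∀ {k} →
               Reach (coordBody ++ k , s) k (CoordInv code (suc p))
  coord-step {code} p {state N X I M} p<slots (consts , e12 , e10 , rest) =
    steps 2 $
    while-rule (SumInv code p)
      (λ _ → λ (((_ , _ , _ , _ , e4 , _) , _) , _ , e13 , _) → e13 , e4)
      sum-step
      (consts , e12 , refl , e10 , refl , rest) >>= λ
      {s} (consts@((_ , e1 , _) , _) , e12 , _ , e10 , sum , copied , oriented , sided , located) →
    steps 2 $ done
      ( consts , trans (cong₂ _+_ e12 e1) (+-comm p 1)
      , trans e10 (cong (shift code) (sym (+-assoc slots (p * slots) n)))
      , copied-low {State.realMem s} (low e12) copied , oriented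
      , sided-low {M = State.realMem s} (low e12) sided
      , located-≔ {M = State.realMem s} e12 sum located )
    where
    low : ∀ {a} → a ≡ p → a < base
    low refl = <-≤-trans p<slots (m≤n+m slots 4)

  Decoded : ℕ → State → Set c
  Decoded code (state N X I M) =
    Constants code N × Copied M × Oriented code n I × Sided code n 0 M × Located code slots M

  decode-correct : ∀ {code s} → Constants code (State.N s) → Copied (State.realMem s) → ∀ {k} →
                   Reach (decode ++ k , s) k (Decoded code)
  decode-correct {code} {state N X I M} consts@(_ , _ , e8 , _) copied =
    steps 3 $
    while-rule (OrientInv code)
      (λ _ → λ (((e0 , _) , _) , e12 , _) → e12 , e0)
      orient-step
      (consts , refl , e8 , copied , (λ _ ()) , (λ _ _ ()) , λ _ ()) >>= λ
      (consts , _ , e10 , copied , oriented , sided) →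
    steps 1 $
    while-rule (CoordInv code)
      (λ _ → λ (((_ , _ , _ , _ , e4 , _) , _) , e12 , _) → e12 , e4)
      coord-step
      (consts , refl , e10 , copied , oriented , sided , λ _ ()) >>= λ
      (consts , _ , _ , copied , oriented , sided , located) →
    done (consts , copied , oriented , sided , located)

  -- Checking a decoded placement

  module _ (M : ℕ → Carrier) where
    end : ℕ → Carrier
    end u = M u +ᴿ M (base + base + u)

    Inside : ℕ → Set ℓ₂
    Inside u = 0# ≤ᴿ M u × end u ≤ᴿ M (base + u % 3)

    ApartOn : ℕ → ℕ → ℕ → Set ℓ₂
    ApartOn i j k = end (3 * i + k) ≤ᴿ M (3 * j + k) ⊎ end (3 * j + k) ≤ᴿ M (3 * i + k)

    Apart : ℕ → ℕ → Set ℓ₂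
    Apart i j = ∃[ k ] k < 3 × ApartOn i j k

    InsideBelow : ℕ → Set ℓ₂
    InsideBelow p = ∀ q → q < p → Inside q

    PairsBelow : ℕ → ℕ → Set ℓ₂
    PairsBelow i j = (∀ i′ j′ → i′ < i → j′ < i′ → Apart i′ j′) × (∀ j′ → j′ < j → Apart i j′)

    Good : Set ℓ₂
    Good = InsideBelow slots × PairsBelow n 0

  below-pred : ∀ {P : ℕ → Set ℓ₂} {m} → (∀ q → q < suc m → P q) → ∀ q → q < m → P q
  below-pred below q q<m = below q (m≤n⇒m≤1+n q<m)

  InsideInv : ℕ → (ℕ → ℕ) → (ℕ → Carrier) → ℕ → State → Set _
  InsideInv code I M p s =
    Constants code (State.N s) × State.N s 12 ≡ p ×
    Flag (State.N s 11) (InsideBelow M p) (¬ InsideBelow M p) ×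
    State.intMem s ≡ I × State.realMem s ≡ M

  inside-step : ∀ {code I M} p {s} → p < slots → InsideInv code I M p s → ∀ {k} →
                Reach (insideBody ++ k , s) k (InsideInv code I M (suc p))
  inside-step {code} {I} {M} p {state N X .I .M} p<slots
    (consts@((_ , e1 , e2 , e3 , _ , e5 , _) , _) , e12 , flag , refl , refl) =
    steps 2 $ branch-X
      (λ 0≤ → steps 3 $ rem-step e5 $ steps 2 $ branch-X
        (λ ≤c → steps 1 $ done (consts , next , flag-map
           (below-suc (subst (0# ≤ᴿ_) (cong M e12) 0≤ , subst₂ _≤ᴿ_ end≡ container≡ ≤c))
           (λ ¬below below → ¬below (below-pred below)) flag , refl , refl))
        (λ ≰c → steps 2 $ done (consts , next , inj₂ (refl , λ below →
           ≰c (subst₂ _≤ᴿ_ (sym end≡) (sym container≡) (proj₂ (below p ≤-refl)))) , refl , refl)))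
      -- The second test runs even after the first has failed; whatever its outcome, the flag is
      -- already 1.
      (λ 0≰ → let bad : ¬ InsideBelow M (suc p)
                  bad below = 0≰ (subst (0# ≤ᴿ_) (cong M (sym e12)) (proj₁ (below p ≤-refl))) in
        steps 4 $ rem-step e5 $ steps 2 $ branch-X
        (λ _ → steps 1 $ done (consts , next , inj₂ (refl , bad) , refl , refl))
        (λ _ → steps 2 $ done (consts , next , inj₂ (refl , bad) , refl , refl)))
    where
    next : N 12 + N 1 ≡ suc p
    next = trans (cong₂ _+_ e12 e1) (+-comm p 1)
    end≡ : M (N 12) +ᴿ M (N 3 + N 12) ≡ end M p
    end≡ = cong₂ _+ᴿ_ (cong M e12) (cong M (cong₂ _+_ e3 e12))
    container≡ : M (N 2 + N 12 % 3) ≡ M (base + p % 3)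
    container≡ = cong M (cong₂ (λ b u → b + u % 3) e2 e12)

  AxisInv : (code : ℕ) (I : ℕ → ℕ) (M : ℕ → Carrier) (i j k : ℕ) → State → Set _
  AxisInv code I M i j k s =
    Constants code (State.N s) × State.N s 12 ≡ i × State.N s 13 ≡ j × State.N s 14 ≡ k ×
    Flag (State.N s 17) (∀ l → l < k → ¬ ApartOn M i j l) (∃[ l ] l < k × ApartOn M i j l) ×
    Flag (State.N s 11) (InsideBelow M slots × PairsBelow M i j)
                        (¬ (InsideBelow M slots × PairsBelow M i j)) ×
    State.intMem s ≡ I × State.realMem s ≡ M

  axis-step : ∀ {code I M i j} l {s} → l < 3 → AxisInv code I M i j l s → ∀ {k} →
              Reach (axisBody ++ k , s) k (AxisInv code I M i j (suc l))
  axis-step {code} {I} {M} {i} {j} l {state N X .I .M} l<3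
    (consts@((_ , e1 , e2 , e3 , _ , e5 , _) , _) , e12 , e13 , e14 , flag , flag′ , refl , refl) =
    steps 12 $ branch-X
      (λ i≤j → steps 1 $ branch-X
        (λ _ → steps 2 $ done (consts , e12 , e13 , next , inj₂ (refl , ij i≤j) , flag′ , refl , refl))
        (λ _ → steps 1 $ done (consts , e12 , e13 , next , inj₂ (refl , ij i≤j) , flag′ , refl , refl)))
      (λ i≰j → branch-X
        (λ j≤i → steps 2 $ done (consts , e12 , e13 , next , inj₂ (refl , ji j≤i) , flag′ , refl , refl))
        (λ j≰i → steps 1 $ done (consts , e12 , e13 , next , flag-map (none i≰j j≰i) weaken flag , flag′ , refl , refl)))
    where
    next : N 14 + N 1 ≡ suc l
    next = trans (cong₂ _+_ e14 e1) (+-comm l 1)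
    u v : ℕ
    u = N 5 * N 12 + N 14
    v = N 5 * N 13 + N 14
    u≡ : u ≡ 3 * i + l
    u≡ = cong₂ _+_ (cong₂ _*_ e5 e12) e14
    v≡ : v ≡ 3 * j + l
    v≡ = cong₂ _+_ (cong₂ _*_ e5 e13) e14
    end′ : ℕ → Carrier
    end′ w = M w +ᴿ M (N 3 + w)
    end≡ : ∀ {w w′} → w ≡ w′ → end′ w ≡ end M w′
    end≡ refl = cong (λ b → M _ +ᴿ M (b + _)) e3
    ij : end′ u ≤ᴿ M v → ∃[ l′ ] l′ < suc l × ApartOn M i j l′
    ij i≤j = l , ≤-refl , inj₁ (subst₂ _≤ᴿ_ (end≡ u≡) (cong M v≡) i≤j)
    ji : end′ v ≤ᴿ M u → ∃[ l′ ] l′ < suc l × ApartOn M i j l′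
    ji j≤i = l , ≤-refl , inj₂ (subst₂ _≤ᴿ_ (end≡ v≡) (cong M u≡) j≤i)
    none : ¬ end′ u ≤ᴿ M v → ¬ end′ v ≤ᴿ M u →
           (∀ l′ → l′ < l → ¬ ApartOn M i j l′) → ∀ l′ → l′ < suc l → ¬ ApartOn M i j l′
    none i≰j j≰i = below-suc λ where
      (inj₁ i≤j) → i≰j (subst₂ _≤ᴿ_ (sym (end≡ u≡)) (cong M (sym v≡)) i≤j)
      (inj₂ j≤i) → j≰i (subst₂ _≤ᴿ_ (sym (end≡ v≡)) (cong M (sym u≡)) j≤i)
    weaken : ∃[ l′ ] l′ < l × ApartOn M i j l′ → ∃[ l′ ] l′ < suc l × ApartOn M i j l′
    weaken (l′ , l′<l , apart) = l′ , m≤n⇒m≤1+n l′<l , apart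

  PairInv : (code : ℕ) (I : ℕ → ℕ) (M : ℕ → Carrier) (i j : ℕ) → State → Set _
  PairInv code I M i j s =
    Constants code (State.N s) × State.N s 12 ≡ i × State.N s 13 ≡ j ×
    Flag (State.N s 11) (InsideBelow M slots × PairsBelow M i j)
                        (¬ (InsideBelow M slots × PairsBelow M i j)) ×
    State.intMem s ≡ I × State.realMem s ≡ M

  pair-step : ∀ {code I M i} j {s} → j < i → PairInv code I M i j s → ∀ {k} →
              Reach (pairBody ++ k , s) k (PairInv code I M i (suc j))
  pair-step {code} {I} {M} {i} j {state N X .I .M} j<i (consts , e12 , e13 , flag , refl , refl) =
    steps 2 $
    while-rule (AxisInv code I M i j)
      (λ _ → λ (((_ , _ , _ , _ , _ , e5 , _) , _) , _ , _ , e14 , _) → e14 , e5)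
      axis-step
      (consts , e12 , e13 , refl , inj₁ (refl , λ _ ()) , flag , refl , refl) >>= λ
    { (consts@((_ , e1 , _) , _) , e12 , e13 , _ , inj₁ (e17 , none) , flag , refl , refl) →
      branch-N
        (λ _ → steps 2 $ done (consts , e12 , next e13 e1 , inj₂ (refl , bad none) , refl , refl))
        (λ 17≮1 → contradiction (subst₂ _<_ (sym e17) (sym e1) (s≤s z≤n)) 17≮1)
    ; (consts@((_ , e1 , _) , _) , e12 , e13 , _ , inj₂ (e17 , apart) , flag , refl , refl) →
      branch-N
        (λ 17<1 → contradiction (subst₂ _<_ e17 e1 17<1) (<-irrefl refl))
        (λ _ → steps 1 $ done (consts , e12 , next e13 e1 , flag-map
          (λ (inside , rows , row) → inside , rows , below-suc apart row)
          (λ ¬A (inside , rows , row) → ¬A (inside , rows , below-pred row)) flag , refl , refl)) }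
    where
    next : ∀ {v w} → v ≡ j → w ≡ 1 → v + w ≡ suc j
    next refl refl = +-comm j 1
    bad : (∀ l → l < 3 → ¬ ApartOn M i j l) → ¬ (InsideBelow M slots × PairsBelow M i (suc j))
    bad none (_ , _ , row) with row j ≤-refl
    ... | l , l<3 , apart = none l l<3 apart

  RowInv : (code : ℕ) (I : ℕ → ℕ) (M : ℕ → Carrier) (i : ℕ) → State → Set _
  RowInv code I M i s =
    Constants code (State.N s) × State.N s 12 ≡ i ×
    Flag (State.N s 11) (InsideBelow M slots × PairsBelow M i 0)
                        (¬ (InsideBelow M slots × PairsBelow M i 0)) ×
    State.intMem s ≡ I × State.realMem s ≡ M

  row-step : ∀ {code I M} i {s} → i < n → RowInv code I M i s → ∀ {k} →
             Reach (rowBody ++ k , s) k (RowInv code I M (suc i))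
  row-step {code} {I} {M} i {state N X .I .M} _ (consts , e12 , flag , refl , refl) =
    steps 1 $
    while-rule (PairInv code I M i)
      (λ _ → λ (_ , e12 , e13 , _) → e13 , e12)
      pair-step
      (consts , e12 , refl , flag , refl , refl) >>= λ
      { (consts@((_ , e1 , _) , _) , e12 , _ , flag , refl , refl) →
    steps 1 $ done
      ( consts , trans (cong₂ _+_ e12 e1) (+-comm i 1)
      , flag-map (map₂ complete) (λ ¬A A → ¬A (map₂ split A)) flag , refl , refl ) }
    where
    complete : PairsBelow M i i → PairsBelow M (suc i) 0
    complete (rows , row) = rows′ , λ _ ()
      where
      rows′ : ∀ i′ j′ → i′ < suc i → j′ < i′ → Apart M i′ j′
      rows′ i′ j′ i′<1+i = below-suc {P = λ i′ → ∀ j′ → j′ < i′ → Apart M i′ j′} row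
        (λ i′ i′<i j′ → rows i′ j′ i′<i) i′ i′<1+i j′
    split : PairsBelow M (suc i) 0 → PairsBelow M i i
    split (rows , _) = (λ i′ j′ i′<i → rows i′ j′ (m≤n⇒m≤1+n i′<i)) , λ j′ → rows i j′ ≤-refl

  check-correct : ∀ {code s} → Constants code (State.N s) → ∀ {k} →
    Reach (check ++ k , s) k λ s′ →
      Constants code (State.N s′) ×
      Flag (State.N s′ 11) (Good (State.realMem s)) (¬ Good (State.realMem s)) ×
      State.intMem s′ ≡ State.intMem s × State.realMem s′ ≡ State.realMem s
  check-correct {code} {state N X I M} consts =
    steps 2 $
    while-rule (InsideInv code I M)
      (λ _ → λ (((_ , _ , _ , _ , e4 , _) , _) , e12 , _) → e12 , e4)
      inside-step
      (consts , refl , inj₁ (refl , λ _ ()) , refl , refl) >>= λ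
    { (consts , _ , flag , refl , refl) →
    steps 1 $
    while-rule (RowInv code I M)
      (λ _ → λ (((e0 , _) , _) , e12 , _) → e12 , e0)
      row-step
      (consts , refl , flag-map (λ inside → inside , (λ _ _ ()) , λ _ ())
        (λ ¬A (inside , _) → ¬A inside) flag , refl , refl) >>= λ
    { (consts , _ , flag , refl , refl) → done (consts , flag , refl , refl) } }

  -- Trying all codes

  Represents : ℕ → (ℕ → Carrier) → Set c
  Represents code M = Copied M × Sided code n 0 M × Located code slots M

  -- Later codes overwrite the memory of a failed one, so it survives only as a witness. This
  -- suffices, since `Represents` fixes every cell that `Good` reads.
  Failed : ℕ → Set _
  Failed code = ∃[ M ] Represents code M × ¬ Good M

  Found : (ℕ → ℕ) → (ℕ → Carrier) → Set _
  Found I M = ∃[ code ] Oriented code n I × Represents code M × Good M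

  Outcome : ℕ → State → Set _
  Outcome m (state N X I M) =
    Flag (N 9) (Copied M × (∀ code → code < m → Failed code)) (Found I M)

  SearchInv : ℕ → State → Set _
  SearchInv code s = Sizes (State.N s) × State.N s 7 ≡ codes × State.N s 8 ≡ code × Outcome code s

  code-step : ∀ code {s} → code < codes → SearchInv code s → ∀ {k} →
              Reach (codeBody ++ k , s) k (SearchInv (suc code))
  code-step code {state N X I M} _ (sizes@(_ , e1 , _) , e7 , e8 , inj₂ (e9 , found)) =
    branch-N
      (λ 9<1 → contradiction (subst₂ _<_ e9 e1 9<1) (<-irrefl refl))
      (λ _ → steps 1 $ done (sizes , e7 , trans (cong₂ _+_ e8 e1) (+-comm code 1) , inj₂ (e9 , found)))
  code-step code {state N X I M} _
    (sizes@(_ , e1 , _) , e7 , e8 , inj₁ (e9 , copied , failed)) =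
    branch-N
      (λ _ → decode-correct (sizes , e7 , e8 , e9) copied >>= λ
        { {state _ _ _ M} (consts , copied , oriented , sided , located) →
        check-correct consts >>= λ
        { ((sizes@(_ , e1 , _) , e7 , e8 , e9) , inj₁ (e11 , good) , refl , refl) →
          branch-N
            (λ _ → steps 2 $ done
              ( sizes , e7 , next e8 e1
              , inj₂ (refl , code , oriented , (copied , sided , located) , good) ))
            (λ 11≮1 → contradiction (subst₂ _<_ (sym e11) (sym e1) (s≤s z≤n)) 11≮1)
        ; ((sizes@(_ , e1 , _) , e7 , e8 , e9) , inj₂ (e11 , bad) , refl , refl) →
          branch-N
            (λ 11<1 → contradiction (subst₂ _<_ e11 e1 11<1) (<-irrefl refl))
            (λ _ → steps 1 $ done
              ( sizes , e7 , next e8 e1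
              , inj₁ (e9 , copied , below-suc (M , (copied , sided , located) , bad) failed) )) } })
      (λ 9≮1 → contradiction (subst₂ _<_ (sym e9) (sym e1) (s≤s z≤n)) 9≮1)
    where
    next : ∀ {v w} → v ≡ code → w ≡ 1 → v + w ≡ suc code
    next refl refl = +-comm code 1

  -- Copying the input and computing the number of codes

  CopyInv : ℕ → State → Set c
  CopyInv i (state N X I M) =
    Sizes N × N 12 ≡ i ×
    (∀ e → e < base → M e ≡ parameter e) × (∀ e → e < i → M (base + e) ≡ parameter e)

  -- Positions have to be output in the cells that hold the input, hence the copy. Source and target
  -- are disjoint blocks of `base` cells, so what is still to be read stays intact.
  copy-step : ∀ i {s} → i < base → CopyInv i s → ∀ {k} →
              Reach (copyBody ++ k , s) k (CopyInv (suc i))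
  copy-step i {state N X I M} i<base (sizes@(_ , e1 , e2 , _) , e12 , given , copied) =
    steps 4 $ done (sizes , trans (cong₂ _+_ e12 e1) (+-comm i 1) ,
                    given′ , copied′)
    where
    to : N 2 + N 12 ≡ base + i
    to = cong₂ _+_ e2 e12
    given′ : ∀ e → e < base → (M [ N 2 + N 12 ≔ M (N 12) ]) e ≡ parameter e
    given′ e e<base = trans
      (≔-other M _ (λ eq → <⇒≢ (<-≤-trans e<base (m≤m+n base i)) (trans eq to)))
      (given e e<base)
    copied′ : ∀ e → e < suc i → (M [ N 2 + N 12 ≔ M (N 12) ]) (base + e) ≡ parameter e
    copied′ = below-suc
      (trans (cong (M [ N 2 + N 12 ≔ M (N 12) ]) (sym to))
        (trans (≔-same M (N 2 + N 12) _) (trans (cong M e12) (given i i<base))))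
      λ e e<i → trans (≔-other M _ (λ eq → <⇒≢ (+-monoʳ-< base e<i) (trans eq to))) (copied e e<i)

  ScaleInv : ℕ → State → Set c
  ScaleInv i (state N X I M) =
    Sizes N × N 7 ≡ base ^ i × N 12 ≡ i × N 16 ≡ n + slots * slots × Copied M

  scale-step : ∀ i {s} → i < n + slots * slots → ScaleInv i s → ∀ {k} →
               Reach (scaleBody ++ k , s) k (ScaleInv (suc i))
  scale-step i {state N X I M} _ (sizes@(_ , e1 , e2 , _) , e7 , e12 , e16 , copied) =
    steps 2 $ done (sizes , cong₂ _*_ e2 e7 ,
                    trans (cong₂ _+_ e12 e1) (+-comm i 1) , e16 , copied)

  packing-correct :
    Reach (packing , inputState n parameters) [] λ (state N X I M) →
      Flag (N 0) (∀ code → code < codes → Failed code) (Found I M)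
  packing-correct =
    steps 8 $
    while-rule CopyInv
      (λ _ → λ ((_ , _ , e2 , _) , e12 , _) → e12 , e2)
      copy-step
      ((refl , refl , refl , refl , refl , refl , refl) , refl , (λ _ _ → refl) , λ _ ()) >>= λ
      (sizes@(e0 , _ , _ , _ , e4 , _) , _ , _ , copied) →
    steps 4 $
    while-rule ScaleInv
      (λ _ → λ (_ , _ , e12 , e16 , _) → e12 , e16)
      scale-step
      (sizes , refl , refl , cong₂ _+_ e0 (cong₂ _*_ e4 e4) , copied) >>= λ
      (sizes , e7 , _ , _ , copied) →
    steps 2 $
    while-rule SearchInv
      (λ _ → λ (_ , e7 , e8 , _) → e8 , e7)
      code-step
      (sizes , e7 , refl , inj₁ (refl , copied , λ _ ())) >>= λ
      (_ , _ , _ , outcome) →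
    steps 2 $ done (flag-map proj₂ id outcome)

-- Rounding coordinates by rank

module Rounding {c ℓ₁ ℓ₂ p} (R : RealNumbers c ℓ₁ ℓ₂ p)
                (n : ℕ) (parameters : List (RealNumbers.Carrier R)) where
  open RealNumbers R
  open OrderedField R
  open Search R n parameters
  open Digits base

  parameterSum-cong : ∀ {g h} t → (∀ s → s ℕ.< t → g s ≡ h s) →
                      parameterSum g t ≡ parameterSum h t
  parameterSum-cong zero    g≡h = refl
  parameterSum-cong (suc t) g≡h = cong₂ (λ u e → u + parameter e)
    (parameterSum-cong t (λ s s<t → g≡h s (ℕ.m≤n⇒m≤1+n s<t))) (g≡h t ℕ.≤-refl)

  -- The index null of a zero parameter pads short sums.
  module _ (null : ℕ) (null<base : null ℕ.< base) (null≡0 : parameter null ≡ 0#) where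

    -- Exactly `t` summands, with repetition; padding by `null` turns this into at most `t`.
    -- Repetition keeps the extension of a sum free of side conditions, and the bound on all of `g`
    -- is what `encode` expects.
    IsSum : ℕ → Carrier → Set _
    IsSum t v = ∃[ g ] (∀ s → g s ℕ.< base) × v ≈ parameterSum g t

    isSum-suc : ∀ {t v e} → e ℕ.< base → IsSum t v → IsSum (suc t) (v + parameter e)
    isSum-suc {t} {v} {e} e<base (g , g<base , v≈) = g [ t ≔ e ] , g′<base , v+e≈
      where
      g′<base : ∀ s → (g [ t ≔ e ]) s ℕ.< base
      g′<base s with s ≡ᵇ t
      ... | true  = e<base
      ... | false = g<base s
      v+e≈ : v + parameter e ≈ parameterSum (g [ t ≔ e ]) (suc t)
      v+e≈ = +-cong
        (≈-trans v≈ (≡⇒≈ (parameterSum-cong t λ s s<t → sym (≔-other g e (ℕ.<⇒≢ s<t)))))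
        (≡⇒≈ (cong parameter (sym (≔-same g t e))))

    isSum-≈ : ∀ t {v v′} → v ≈ v′ → IsSum t v → IsSum t v′
    isSum-≈ t v≈v′ (g , g<base , v≈) = g , g<base , ≈-trans (≈-sym v≈v′) v≈

    isSum-pad : ∀ {t v} → IsSum t v → IsSum (suc t) v
    isSum-pad {t} {v} sum =
      isSum-≈ (suc t) (≈-trans (+-congˡ (≡⇒≈ null≡0)) (+-identityʳ v)) (isSum-suc null<base sum)

    isSum-mono : ∀ {t t′ v} → t ≤′ t′ → IsSum t v → IsSum t′ v
    isSum-mono ≤′-refl        sum = sum
    isSum-mono (≤′-step t≤t′) sum = isSum-pad (isSum-mono t≤t′ sum)

    isSum-0 : ∀ t → IsSum t 0#
    isSum-0 zero    = (λ _ → null) , (λ _ → null<base) , ≈-refl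
    isSum-0 (suc t) = isSum-pad (isSum-0 t)

    argmax : ∀ (f : ℕ → Carrier) y m →
      (∀ k → k ℕ.< m → ¬ f k ≤ y) ⊎
      (∃[ k ] f k ≤ y × (∀ k′ → k′ ℕ.< m → f k′ ≤ y → f k′ ≤ f k))
    argmax f y zero = inj₁ λ _ ()
    argmax f y (suc m) with f m ≤? y | argmax f y m
    ... | no fm≰y  | inj₁ none = inj₁ (below-suc fm≰y none)
    ... | yes fm≤y | inj₁ none = inj₂ (m , fm≤y ,
      below-suc (λ _ → ≤-refl) λ k k<m fk≤y → contradiction fk≤y (none k k<m))
    ... | no fm≰y  | inj₂ (l , fl≤y , max) = inj₂ (l , fl≤y ,
      below-suc (λ fm≤y → contradiction fm≤y fm≰y) max)
    ... | yes fm≤y | inj₂ (l , fl≤y , max) with total (f m) (f l)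
    ...   | inj₁ fm≤fl = inj₂ (l , fl≤y , below-suc (λ _ → fm≤fl) max)
    ...   | inj₂ fl≤fm = inj₂ (m , fm≤y ,
      below-suc (λ _ → ≤-refl) λ k k<m fk≤y → ≤-trans (max k k<m fk≤y) fl≤fm)

    Rounded : ℕ → Carrier → Carrier → Set _
    Rounded t y v = IsSum t v × v ≤ y × (∀ v′ → IsSum t v′ → v′ ≤ y → v′ ≤ v)

    -- Every sum of `t` parameters has a code below `base ^ t`, so finitely many comparisons find
    -- the largest one that is at most `y`. An admissible one exists because 0 is a sum.
    round : ∀ t y → 0# ≤ y → ∃[ v ] Rounded t y v
    round t y 0≤y with argmax (λ code → parameterSum (digit code) t) y (base ^ t)
    ... | inj₂ (code , ≤y , max) =
      parameterSum (digit code) t ,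
      (digit code , digit<b code , ≈-refl) , ≤y , λ v′ (g , g<base , v′≈) v′≤y →
        let code′ , code′< , digits = encode t g g<base
            v′≈′ = ≈-trans v′≈ (≡⇒≈ (parameterSum-cong t λ s s<t → sym (digits s s<t)))
        in ≤-trans (≤-reflexive v′≈′) (max code′ code′< (≤-resp₂ v′≈′ ≈-refl v′≤y))
    ... | inj₁ none with isSum-0 t
    ...   | g , g<base , 0≈ with encode t g g<base
    ...     | code , code< , digits = contradiction
              (≤-resp₂ (≈-trans 0≈ (≡⇒≈ (parameterSum-cong t λ s s<t → sym (digits s s<t)))) ≈-refl 0≤y)
              (none code code<)

    module _ (x : ℕ → Carrier) where

      countBelow : Carrier → ℕ → ℕ
      countBelow y zero    = 0
      countBelow y (suc t) with y ≤? x t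
      ... | yes _ = countBelow y t
      ... | no _  = suc (countBelow y t)

      countBelow≤ : ∀ y t → countBelow y t ℕ.≤ t
      countBelow≤ y zero = z≤n
      countBelow≤ y (suc t) with y ≤? x t
      ... | yes _ = ℕ.m≤n⇒m≤1+n (countBelow≤ y t)
      ... | no _  = s≤s (countBelow≤ y t)

      countBelow-mono : ∀ {y y′} → y ≤ y′ → ∀ t → countBelow y t ℕ.≤ countBelow y′ t
      countBelow-mono y≤y′ zero = z≤n
      countBelow-mono {y} {y′} y≤y′ (suc t) with y ≤? x t | y′ ≤? x t
      ... | yes _   | yes _    = countBelow-mono y≤y′ t
      ... | yes _   | no _     = ℕ.m≤n⇒m≤1+n (countBelow-mono y≤y′ t)
      ... | no y≰xt | yes y′≤xt = contradiction (≤-trans y≤y′ y′≤xt) y≰xt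
      ... | no _    | no _     = s≤s (countBelow-mono y≤y′ t)

      -- Whatever is below `x p` is below `y`, and the entry at `p` is below `y` but not below
      -- itself.
      countBelow-< : ∀ {y t} p → p ℕ.< t → x p ≤ y → ¬ y ≤ x p → countBelow (x p) t ℕ.< countBelow y t
      countBelow-< {y} {suc t} p p<1+t xp≤y y≰xp with ℕ.m<1+n⇒m<n∨m≡n p<1+t
      countBelow-< {y} {suc t} p p<1+t xp≤y y≰xp | inj₁ p<t with x p ≤? x t | y ≤? x t
      ... | yes _    | yes _   = countBelow-< p p<t xp≤y y≰xp
      ... | yes _    | no _    = ℕ.m≤n⇒m≤1+n (countBelow-< p p<t xp≤y y≰xp)
      ... | no xp≰xt | yes y≤xt = contradiction (≤-trans xp≤y y≤xt) xp≰xt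
      ... | no _     | no _    = s≤s (countBelow-< p p<t xp≤y y≰xp)
      countBelow-< {y} {suc t} p p<1+t xp≤y y≰xp | inj₂ refl with x p ≤? x p | y ≤? x p
      ... | yes _    | no _    = s≤s (countBelow-mono xp≤y p)
      ... | yes _    | yes y≤xp = contradiction y≤xp y≰xp
      ... | no xp≰xp | _       = contradiction ≤-refl xp≰xp

      rank : ℕ → ℕ
      rank p = countBelow (x p) slots

      -- Two lengths meet here: the value is written with `slots` summands, as a code has them, but
      -- is maximal only among sums of `rank p` summands.
      Compressed : ℕ → (ℕ → ℕ) → Set _
      Compressed p g = 0# ≤ v × Rounded (rank p) (x p) v
        where v = parameterSum g slots

      compress : ∀ p → ∃[ g ] (∀ s → g s ℕ.< base) × (0# ≤ x p → Compressed p g)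
      compress p with 0# ≤? x p
      -- A default for negative coordinates, about which nothing is claimed; it makes the choice of
      -- digits total.
      ... | no 0≰ = (λ _ → null) , (λ _ → null<base) , λ 0≤ → contradiction 0≤ 0≰
      ... | yes 0≤ with round (rank p) (x p) 0≤
      ...   | v , sum , v≤x , max with isSum-mono (ℕ.≤⇒≤′ (countBelow≤ (x p) slots)) sum
      ...     | g , g<base , v≈ = g , g<base , λ _ →
                ≤-resp₂ ≈-refl v≈ (max 0# (isSum-0 (rank p)) 0≤) ,
                isSum-≈ (rank p) v≈ sum , ≤-resp₂ v≈ ≈-refl v≤x ,
                λ v′ sum′ v′≤x → ≤-resp₂ ≈-refl v≈ (max v′ sum′ v′≤x)

      compressed-end≤ : ∀ {p q g h e} → p ℕ.< slots → e ℕ.< base →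
        0# ≤ parameter e → ¬ parameter e ≤ 0# → Compressed p g → Compressed q h →
        x p + parameter e ≤ x q →
        parameterSum g slots + parameter e ≤ parameterSum h slots
      compressed-end≤ {p} {q} {g} {h} {e} p<slots e<base 0≤e e≰0 (_ , sum , v≤x , _) (_ , _ , _ , max) end≤ =
        max _ (isSum-mono (ℕ.≤⇒≤′ rank<) (isSum-suc e<base sum))
          (≤-trans (+-monoˡ-≤ (parameter e) v≤x) end≤)
        where
        rank< : rank p ℕ.< rank q
        -- The positive side makes the coordinate at `q` strictly larger, and the gain in rank pays
        -- for the summand `e`.
        rank< = countBelow-< p p<slots (≤-trans (x≤x+y (x p) 0≤e) end≤)
          λ xq≤xp → e≰0 (x+y≤x⇒y≤0 (x p) (≤-trans end≤ xq≤xp))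

-- From good memories to feasible placements and back

module Correctness {c ℓ₁ ℓ₂ p} (R : RealNumbers c ℓ₁ ℓ₂ p) (I : Packing.Instance R) where
  open RealNumbers R
  open OrderedField R
  open Packing R
  open Instance I
  open Geometry R I
  open Execution R
  open Search R n (parameters I)
  open Rounding R n (parameters I)
  open Digits base

  triples : ∀ {m} → (Fin m → Point) → List Carrier
  triples f = concat (tabulate λ i → f i 0F ∷ f i 1F ∷ f i 2F ∷ [])

  memory-triples : ∀ {m} (f : Fin m → Point) i k → memory (triples f) (3 ℕ.* toℕ i ℕ.+ toℕ k) ≡ f i k
  memory-triples f zero 0F = refl
  memory-triples f zero 1F = refl
  memory-triples f zero 2F = refl
  memory-triples f (suc i) k = trans
    (cong (λ j → memory (triples f) (j ℕ.+ toℕ k)) (ℕ.*-suc 3 (toℕ i)))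
    (memory-triples (f ∘ suc) i k)

  memory-triples-end : ∀ {m} (f : Fin m → Point) → memory (triples f) (3 ℕ.* m) ≡ 0#
  memory-triples-end {zero}  f = refl
  memory-triples-end {suc m} f = trans
    (cong (memory (triples f)) (ℕ.*-suc 3 m)) (memory-triples-end (f ∘ suc))

  items : Fin n → Point
  items i = ⟨ l i , w i , h i ⟩

  parameter-item : ∀ i k → parameter (3 ℕ.+ (3 ℕ.* toℕ i ℕ.+ toℕ k)) ≡ items i k
  parameter-item = memory-triples items

  parameter-container : ∀ k → parameter (toℕ k) ≡ sizes k
  parameter-container 0F = refl
  parameter-container 1F = refl
  parameter-container 2F = refl

  -- The six orientations list the permutations of 0, 1, 2 lexicographically. `perm` computes them
  -- with machine operations: the first entry is `o / 2`, and the last is what the other two leave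
  -- of 0 + 1 + 2 = 3. Here the formula meets the table, case by case.
  parameter-side : ∀ o i k → parameter (sideOf (toℕ o) (toℕ i) (toℕ k)) ≡ dimensions I o i k
  parameter-side 0F i 0F = parameter-item i 0F
  parameter-side 0F i 1F = parameter-item i 1F
  parameter-side 0F i 2F = parameter-item i 2F
  parameter-side 1F i 0F = parameter-item i 0F
  parameter-side 1F i 1F = parameter-item i 2F
  parameter-side 1F i 2F = parameter-item i 1F
  parameter-side 2F i 0F = parameter-item i 1F
  parameter-side 2F i 1F = parameter-item i 0F
  parameter-side 2F i 2F = parameter-item i 2F
  parameter-side 3F i 0F = parameter-item i 1F
  parameter-side 3F i 1F = parameter-item i 2F
  parameter-side 3F i 2F = parameter-item i 0F
  parameter-side 4F i 0F = parameter-item i 2F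
  parameter-side 4F i 1F = parameter-item i 0F
  parameter-side 4F i 2F = parameter-item i 1F
  parameter-side 5F i 0F = parameter-item i 2F
  parameter-side 5F i 1F = parameter-item i 1F
  parameter-side 5F i 2F = parameter-item i 0F

  slot : Fin n → Fin 3 → ℕ
  slot i k = 3 ℕ.* toℕ i ℕ.+ toℕ k

  slot<slots : ∀ i k → slot i k ℕ.< slots
  slot<slots i k = slot<3n (toℕ<n i) (toℕ<n k)

  slot%3 : ∀ i k → slot i k % 3 ≡ toℕ k
  slot%3 i k = begin
    (3 ℕ.* toℕ i ℕ.+ toℕ k) % 3  ≡⟨ cong (_% 3) (ℕ.+-comm (3 ℕ.* toℕ i) (toℕ k)) ⟩
    (toℕ k ℕ.+ 3 ℕ.* toℕ i) % 3  ≡⟨ cong (λ j → (toℕ k ℕ.+ j) % 3) (ℕ.*-comm 3 (toℕ i)) ⟩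
    (toℕ k ℕ.+ toℕ i ℕ.* 3) % 3  ≡⟨ [m+kn]%n≡m%n (toℕ k) (toℕ i) 3 ⟩
    toℕ k % 3                    ≡⟨ m<n⇒m%n≡m (toℕ<n k) ⟩
    toℕ k                        ∎
    where open ≡-Reasoning

  module _ {code : ℕ} {M : ℕ → Carrier} (o : Fin n → Orientation)
           (o≡ : ∀ (i : Fin n) → orientationOf code (toℕ i) ≡ toℕ (o i))
           (represents : Represents code M) where

    placement : Placement I
    placement = record { orientation = o ; position = λ i k → M (slot i k) }

    end≡ : ∀ i k → end M (slot i k) ≡ M (slot i k) + side placement i k
    end≡ i k = cong (M (slot i k) +_)
      (trans (proj₁ (proj₁ (proj₂ represents)) (toℕ i) (toℕ k) (toℕ<n i) (toℕ<n k)) (trans (cong (λ o → parameter (sideOf o (toℕ i) (toℕ k))) (o≡ i)) (parameter-side (o i) i k)))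

    container≡ : ∀ i k → M (base ℕ.+ slot i k % 3) ≡ sizes k
    container≡ i k = trans
      (proj₁ represents _ (ℕ.<-≤-trans (m%n<n (slot i k) 3) (ℕ.m≤m+n 3 (suc slots))))
      (trans (cong parameter (slot%3 i k)) (parameter-container k))

    good⇒feasible : Good M → Feasible I placement
    good⇒feasible (inside , pairs , _) =
      (λ i → contained⇒⊆ placement λ k →
        map₂ (subst₂ _≤_ (end≡ i k) (container≡ i k)) (inside (slot i k) (slot<slots i k))) ,
      λ i j i≢j → separated⇒disjoint placement (separated i j i≢j)
      where
      pair : ∀ i j → toℕ j ℕ.< toℕ i → ∃[ k ] ApartOn M (toℕ i) (toℕ j) (toℕ {3} k)
      pair i j j<i with pairs (toℕ i) (toℕ j) (toℕ<n i) j<i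
      ... | k , k<3 , apart = fromℕ< k<3 , subst (ApartOn M (toℕ i) (toℕ j)) (sym (toℕ-fromℕ< k<3)) apart
      separated : ∀ i j → i ≢ j → Separated placement i j
      -- The check covers only `j < i`; for the other order the two alternatives trade places.
      separated i j i≢j with ℕ.<-cmp (toℕ i) (toℕ j)
      ... | tri≈ _ i≡j _ = contradiction (toℕ-injective i≡j) i≢j
      ... | tri> _ _ j<i with pair i j j<i
      ...   | k , inj₁ i≤j = k , inj₁ (subst (_≤ _) (end≡ i k) i≤j)
      ...   | k , inj₂ j≤i = k , inj₂ (subst (_≤ _) (end≡ j k) j≤i)
      separated i j i≢j | tri< i<j _ _ with pair j i i<j
      ...   | k , inj₁ j≤i = k , inj₂ (subst (_≤ _) (end≡ j k) j≤i)
      ...   | k , inj₂ i≤j = k , inj₁ (subst (_≤ _) (end≡ i k) i≤j)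

    feasible⇒good : (∀ i → Contained placement i) → (∀ i j → i ≢ j → Separated placement i j) → Good M
    feasible⇒good contained separated = inside , pairs , λ _ ()
      where
      inside : InsideBelow M slots
      inside = slot-elim λ i k →
        map₂ (subst₂ _≤_ (sym (end≡ i k)) (sym (container≡ i k))) (contained i k)
      apart : ∀ i j → i ≢ j → Apart M (toℕ i) (toℕ j)
      apart i j i≢j with separated i j i≢j
      ... | k , inj₁ i≤j = toℕ k , toℕ<n k , inj₁ (subst (_≤ _) (sym (end≡ i k)) i≤j)
      ... | k , inj₂ j≤i = toℕ k , toℕ<n k , inj₂ (subst (_≤ _) (sym (end≡ j k)) j≤i)
      pairs : ∀ i j → i ℕ.< n → j ℕ.< i → Apart M i j
      pairs i j i<n j<i = subst₂ (Apart M) (toℕ-fromℕ< i<n) (toℕ-fromℕ< (ℕ.<-trans j<i i<n))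
        (apart (fromℕ< i<n) (fromℕ< (ℕ.<-trans j<i i<n)) λ i≡j → ℕ.<⇒≢ j<i
          (sym (trans (sym (toℕ-fromℕ< i<n)) (trans (cong toℕ i≡j) (toℕ-fromℕ< (ℕ.<-trans j<i i<n))))))

  -- At least one item makes the base at least 7, so an orientation fits into one digit.
  6≤base : 6 ℕ.≤ base
  6≤base = ℕ.≤-trans (ℕ.m≤m+n 6 1) (ℕ.+-monoʳ-≤ 4 (ℕ.*-monoʳ-≤ 3 n>0))

  null : ℕ
  null = 3 ℕ.+ slots

  null<base : null ℕ.< base
  null<base = ℕ.≤-refl

  null≡0 : parameter null ≡ 0#
  null≡0 = memory-triples-end items

  module _ (π : Placement I) (feasible : Feasible I π) where
    open Placement π

    x : ℕ → Carrier
    x = memory (triples position)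

    x≡ : ∀ i k → x (slot i k) ≡ position i k
    x≡ = memory-triples position

    compressed : ∀ p → _
    compressed = compress null null<base null≡0 x

    choice : ℕ → ℕ → ℕ
    choice p = proj₁ (compressed p)

    instance
      slots≢0 : NonZero slots
      slots≢0 = ℕ.>-nonZero (ℕ.<-≤-trans (s≤s z≤n) (ℕ.*-monoʳ-≤ 3 n>0))

    module Slots = Digits slots

    -- This inverts the layout of a code: behind the orientations, the quotient by `slots` is the
    -- coordinate and the remainder its summand.
    coordinates digits : ℕ → ℕ
    coordinates u = choice (u / slots) (u % slots)
    digits = prefix (toℕ ∘ orientation) coordinates

    digits<base : ∀ t → digits t ℕ.< base
    digits<base = prefix-< (toℕ ∘ orientation) coordinates
      (λ i → ℕ.<-≤-trans (toℕ<n (orientation i)) 6≤base)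
      λ u → proj₁ (proj₂ (compressed (u / slots))) (u % slots)

    code : ℕ
    code = proj₁ (encode (n ℕ.+ slots ℕ.* slots) digits digits<base)

    code<codes : code ℕ.< codes
    code<codes = proj₁ (proj₂ (encode (n ℕ.+ slots ℕ.* slots) digits digits<base))

    digit≡ : ∀ t → t ℕ.< n ℕ.+ slots ℕ.* slots → digit code t ≡ digits t
    digit≡ = proj₂ (proj₂ (encode (n ℕ.+ slots ℕ.* slots) digits digits<base))

    orientation≡ : ∀ i → orientationOf code (toℕ i) ≡ toℕ (orientation i)
    orientation≡ i = begin
      digit code (toℕ i) % 6   ≡⟨ cong (_% 6) (digit≡ (toℕ i) (ℕ.<-≤-trans (toℕ<n i) (ℕ.m≤m+n n _))) ⟩
      digits (toℕ i) % 6       ≡⟨ cong (_% 6) (prefix-toℕ (toℕ ∘ orientation) coordinates i) ⟩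
      toℕ (orientation i) % 6  ≡⟨ m<n⇒m%n≡m (toℕ<n (orientation i)) ⟩
      toℕ (orientation i)      ∎
      where open ≡-Reasoning

    coordinate≡ : ∀ p → p ℕ.< slots → coordinateOf code p ≡ parameterSum (choice p) slots
    coordinate≡ p p<slots = parameterSum-cong slots λ t t<slots → begin
      digit code (t ℕ.+ (p ℕ.* slots ℕ.+ n))  ≡⟨ cong (digit code) (index≡ t) ⟩
      digit code (n ℕ.+ (t ℕ.+ p ℕ.* slots))  ≡⟨ digit≡ _ (ℕ.+-monoʳ-< n (index< t<slots)) ⟩
      digits (n ℕ.+ (t ℕ.+ p ℕ.* slots))      ≡⟨ prefix-+ (toℕ ∘ orientation) coordinates _ ⟩
      coordinates (t ℕ.+ p ℕ.* slots)         ≡⟨ cong₂ choice (Slots.[e+c*b]/b≡c p t<slots) (Slots.[e+c*b]%b≡e p t<slots) ⟩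
      choice p t                              ∎
      where
      open ≡-Reasoning
      index≡ : ∀ t → t ℕ.+ (p ℕ.* slots ℕ.+ n) ≡ n ℕ.+ (t ℕ.+ p ℕ.* slots)
      index≡ t = trans (sym (ℕ.+-assoc t (p ℕ.* slots) n)) (ℕ.+-comm (t ℕ.+ p ℕ.* slots) n)
      index< : ∀ {t} → t ℕ.< slots → t ℕ.+ p ℕ.* slots ℕ.< slots ℕ.* slots
      index< t<slots = ℕ.<-≤-trans (ℕ.+-monoˡ-< (p ℕ.* slots) t<slots) (ℕ.*-monoˡ-≤ slots p<slots)

    contained : ∀ i → Contained π i
    contained i = ⊆⇒contained π (proj₁ feasible i)

    separated : ∀ i j → i ≢ j → Separated π i j
    separated i j i≢j = disjoint⇒separated π {i} {j} (proj₂ feasible i j i≢j)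

    -- Stated for every representing memory, because the search supplies an unspecified one for each
    -- failed code. The orientations of `π` are kept and only its positions are rounded.
    feasible⇒code-good : ∀ {M} → Represents code M → Good M
    feasible⇒code-good {M} represents@(_ , _ , located) =
      feasible⇒good orientation orientation≡ represents contained′ separated′
      where
      π′ : Placement I
      π′ = placement orientation orientation≡ represents
      v : Fin n → Fin 3 → Carrier
      v i k = parameterSum (choice (slot i k)) slots
      M≡ : ∀ i k → M (slot i k) ≡ v i k
      M≡ i k = trans (located (slot i k) (slot<slots i k)) (coordinate≡ (slot i k) (slot<slots i k))
      facts : ∀ i k → Compressed null null<base null≡0 x (slot i k) (choice (slot i k))
      facts i k = proj₂ (proj₂ (compressed (slot i k)))
        (subst (0# ≤_) (sym (x≡ i k)) (proj₁ (contained i k)))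
      contained′ : ∀ i → Contained π′ i
      contained′ i k with facts i k
      ... | 0≤v , _ , v≤x , _ =
        subst (0# ≤_) (sym (M≡ i k)) 0≤v ,
        ≤-trans (+-monoˡ-≤ (side π i k) (subst₂ _≤_ (sym (M≡ i k)) (x≡ i k) v≤x)) (proj₂ (contained i k))
      ends : ∀ i j k → position i k + side π i k ≤ position j k →
             M (slot i k) + side π i k ≤ M (slot j k)
      ends i j k end≤ = subst₂ _≤_ (cong₂ _+_ (sym (M≡ i k)) e≡) (sym (M≡ j k))
        (compressed-end≤ null null<base null≡0 x (slot<slots i k)
          (sideOf<base {toℕ (orientation i)} {toℕ i} {toℕ k} (toℕ<n (orientation i)) (toℕ<n i))
          (subst (0# ≤_) (sym e≡) (proj₁ side>0))
          (λ e≤0 → proj₂ side>0 (antisym (proj₁ side>0) (subst (_≤ 0#) e≡ e≤0)))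
          (facts i k) (facts j k)
          (subst₂ _≤_ (cong₂ _+_ (sym (x≡ i k)) (sym e≡)) (sym (x≡ j k)) end≤))
        where
        e≡ : parameter (sideOf (toℕ (orientation i)) (toℕ i) (toℕ k)) ≡ side π i k
        e≡ = parameter-side (orientation i) i k
        side>0 : 0# < side π i k
        side>0 = dimensions>0 (orientation i) i k
      separated′ : ∀ i j → i ≢ j → Separated π′ i j
      separated′ i j i≢j with separated i j i≢j
      ... | k , inj₁ i≤j = k , inj₁ (ends i j k i≤j)
      ... | k , inj₂ j≤i = k , inj₂ (ends j i k j≤i)

  packing-solves : ∃[ s ] Halts packing (inputState n (parameters I)) s × CorrectAnswer I s
  packing-solves = map₂ (λ {s} → map₂ (answer s)) packing-correct
    where
    answer : ∀ s → Flag (State.N s 0) (∀ code → code ℕ.< codes → Failed code)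
                          (Found (State.intMem s) (State.realMem s)) → CorrectAnswer I s
    answer s (inj₁ (verdict , failed)) = inj₂ (verdict , λ (π , feasible) →
      let M , represents , bad = failed (code π feasible) (code<codes π feasible)
      in bad (feasible⇒code-good π feasible represents))
    answer s (inj₂ (verdict , code , oriented , represents , good)) =
      inj₁ (verdict , placement o o≡ represents , good⇒feasible o o≡ represents good ,
        (λ i → trans (oriented (toℕ i) (toℕ<n i)) (o≡ i)) , λ i k → ≈-refl)
      where
      o : Fin n → Orientation
      o i = fromℕ< (m%n<n (digit code (toℕ i)) 6)
      o≡ : ∀ i → orientationOf code (toℕ i) ≡ toℕ (o i)
      o≡ i = sym (toℕ-fromℕ< (m%n<n (digit code (toℕ i)) 6))

theorem3p11 : ∀ {c ℓ₁ ℓ₂ p} → WeaklyComputable {c} {ℓ₁} {ℓ₂} {p} cuboidPacking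
theorem3p11 = packing , λ R I → Correctness.packing-solves R I
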